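{- Let $p$ be a prime and let $a,b,c$ be positive integers such that $c$ is a primitive divisor of $p^a-1$ and $bc$ is a primitive divisor of $p^{ab}-1$. Then the Waring numbers below exist and $$g\Big(\tfrac{p^{ab}-1}{bc},\,p^{ab}\Big)=b\,g\Big(\tfrac{p^a-1}{c},\,p^a\Big).$$
   Context: For a prime power $q$ and a positive integer $k$, the Waring number $g(k,q)$ is the smallest $s$ (if it exists) such that every element of $\mathbb{F}_q$ can be written as $x_1^k+\cdots+x_s^k$ with $x_i\in\mathbb{F}_q$. An integer $e$ is a primitive divisor of $p^a-1$ if $e\mid p^a-1$ and $e\nmid p^t-1$ for every $1\le t<a$. -}

module Defs where

open import Algebra.Apartness.Bundles using (HeytingField; HeytingCommutativeRing)
open import Algebra.Bundles using (CommutativeRing)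
import Algebra.Properties.Monoid.Sum as Sum
import Algebra.Properties.Semiring.Exp as Exp
open import Data.Fin.Base using (Fin)
open import Data.Nat.Base using (ℕ; _∸_; _^_; _≤_; _<_)
open import Data.Nat.Divisibility using (_∣_)
open import Data.Product.Base using (_×_; Σ-syntax)
open import Data.Vec.Functional using (Vector)
open import Function.Bundles using (Inverse)
open import Level using (Level; _⊔_)
open import Relation.Binary.PropositionalEquality using (setoid)
open import Relation.Nullary.Negation using (¬_)

private
  variable
    c ℓ₁ ℓ₂ : Level

-- Truncated subtraction is harmless here: in all uses p is prime, so p ^ t ≥ 1.
IsPrimitiveDivisor : (e p a : ℕ) → Set
IsPrimitiveDivisor e p a =
  (e ∣ p ^ a ∸ 1) × (∀ t → 1 ≤ t → t < a → ¬ (e ∣ p ^ t ∸ 1))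

-- 𝔽_q is represented by an arbitrary field satisfying HasOrder F q. A finite
-- setoid has decidable equality, so for such F the apartness x # y of
-- HeytingField is equivalent to ¬ (x ≈ y), and F is a field in the usual sense
-- (0# and 1# are distinct because _#_ is irreflexive).
module _ (F : HeytingField c ℓ₁ ℓ₂) where

  private
    module R = CommutativeRing
      (HeytingCommutativeRing.commutativeRing (HeytingField.heytingCommutativeRing F))
    module S = Sum R.+-monoid
    module E = Exp R.semiring

  HasOrder : ℕ → Set (c ⊔ ℓ₁)
  HasOrder q = Inverse R.setoid (setoid (Fin q))

  EveryElementIsSumOfPowers : (k s : ℕ) → Set (c ⊔ ℓ₁)
  EveryElementIsSumOfPowers k s =
    ∀ y → Σ[ x ∈ Vector R.Carrier s ] (y R.≈ S.sum (λ i → x i E.^ k))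

  -- The Waring number is a partial function of the field and the exponent, so
  -- it is given by its graph: this says that it exists and is equal to s.
  IsWaringNumber : (k s : ℕ) → Set (c ⊔ ℓ₁)
  IsWaringNumber k s =
    EveryElementIsSumOfPowers k s × (∀ t → EveryElementIsSumOfPowers k t → s ≤ t)

{-# OPTIONS --safe #-}
module Submission where

-- Let ω ∈ L have order b c, and put ζ = ω ^ b, which has order c.  Primitivity makes the conjugates of ζ
-- and of ω as numerous as the degrees of K and L, so ζ generates a copy of K inside L, over which
-- 1, ω, …, ω^(b-1) is a basis.  The nonzero powers in question are the roots of unity ω^i ζ^j, so a
-- representation of Σ yᵢ ω^i is a family of independent representations of the yᵢ, and the worst case is b g.
-- Elements of both fields are written as sums of powers of a root of unity, recorded as lists of
-- exponents, so that K is identified with its copy by comparing the additive relations of two roots of unity.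

-- The obstacle is that `K` and `L` are given as unrelated fields. The elements of order c may have
-- several minimal polynomials over the prime field, so an element `η₀` of order c in `K` need not
-- satisfy the relations of ζ; only a suitable power of it does. Minimal polynomials are avoided by
-- means of finiteness: in a field with n units, 1 - l^n turns vanishing and nonvanishing of l into
-- the values 1 and 0. This device shows both that some power of `η₀` works and that the resulting
-- map is injective. The power is obtained only under a double negation, because satisfying all
-- relations of ζ is a statement about infinitely many lists. That suffices: the Waring numbers are
-- shown to exist independently of it, and the equation between them is decidable. Exponent lists
-- serve two purposes: a list is a polynomial that both fields can evaluate, and it is a sum of
-- powers whose number of terms is its length.

open import Defs
open import Algebra.Apartness.Bundles using (HeytingField; HeytingCommutativeRing)
import Algebra.Apartness.Properties.HeytingCommutativeRing as HeytingCommutativeRingProperties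
open import Algebra.Bundles using (CommutativeRing)
import Algebra.Properties.CommutativeMonoid.Sum as CommutativeMonoidSum
import Algebra.Properties.CommutativeSemiring.Exp as CommutativeSemiringExp
import Algebra.Properties.Monoid.Sum as MonoidSum
import Algebra.Properties.Ring as RingProperties
import Algebra.Properties.Semiring.Binomial as Binomial
import Algebra.Properties.Semiring.Exp as SemiringExp
import Algebra.Properties.Semiring.Mult as SemiringMult
open import Data.Fin.Base using (Fin; zero; suc; toℕ; fromℕ; inject₁; punchIn; punchOut; combine; finToFun; funToFin)
open import Data.Fin.Permutation using (Permutation; permutation; _⟨$⟩ʳ_)
import Data.Fin.Properties as Fin
open import Data.List.Base using (List; []; _∷_; length; map; replicate; tabulate; zipWith; _++_)
open import Data.List.Properties using (length-++; length-map; length-replicate; length-tabulate; map-tabulate)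
open import Data.List.Relation.Binary.Pointwise as Pointwise using (Pointwise; []; _∷_)
open import Data.List.Relation.Unary.All as All using (All; []; _∷_)
import Data.List.Relation.Unary.All.Properties as All
import Data.Nat.Base as ℕ
open import Data.Nat.Base using (ℕ; zero; suc; NonZero; _≤_; _<_; z≤n; s≤s; _!)
import Data.Nat.Properties as ℕ
open import Data.Nat.Combinatorics using (_C_; nCn≡1; nCk≡n!/k![n-k]!; k![n∸k]!∣n!)
open import Data.Nat.Coprimality as Coprimality using (Coprime; coprime-divisor; coprime-Bézout)
open import Data.Nat.Divisibility
open import Data.Nat.DivMod using (m%n<n; m≡m%n+[m/n]*n; m/n*n≡m)
open import Data.Nat.GCD using (module Bézout)
open import Data.Nat.Induction using (<-rec)
open import Data.Nat.ListAction using (sum; product)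
open import Data.Nat.Primality using (Prime; euclidsLemma; prime⇒irreducible; prime⇒nonTrivial; prime⇒nonZero; ¬prime[1])
open import Data.Nat.Primality.Factorisation using (factorise)
open import Data.Product.Base using (_×_; _,_; proj₁; proj₂; uncurry; ∃; ∃-syntax; Σ-syntax)
open import Data.Sum.Base using (_⊎_; inj₁; inj₂)
open import Data.Vec.Functional using (Vector)
open import Function.Base using (_∘_; id)
open import Function.Bundles using (Inverse)
open import Function.Definitions using (Injective)
open import Relation.Binary.PropositionalEquality as ≡ using (_≡_; _≢_; _≗_)
open import Relation.Nullary.Decidable using (Dec; yes; no; map′; ¬?; decidable-stable)
open import Relation.Nullary.Negation using (¬_; contradiction)

-- Arithmetic

module _ where

  open import Data.Nat.Base using (_+_; _*_; _∸_; _^_; _/_)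
  open import Relation.Binary.PropositionalEquality using (refl; sym; trans; cong; subst)

  prime-divisor : ∀ {m} → 2 ≤ m → ∃[ ℓ ] Prime ℓ × ℓ ∣ m
  prime-divisor {m@(suc _)} 2≤m with factorise m
  ... | record { factors = [] ; isFactorisation = eq } = contradiction (subst (2 ≤_) eq 2≤m) λ { (s≤s ()) }
  ... | record { factors = ℓ ∷ ℓs ; isFactorisation = eq ; factorsPrime = ℓ-prime ∷ _ } =
    ℓ , ℓ-prime , subst (ℓ ∣_) (sym eq) (m∣m*n (product ℓs))

  remove-prime : ∀ {ℓ} → Prime ℓ → ∀ m → .{{NonZero m}} → ∃[ e ] ∃[ r ] m ≡ ℓ ^ e * r × ¬ ℓ ∣ r
  remove-prime {ℓ} ℓ-prime m {{m≢0}} = <-rec P step m m≢0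
    where
    instance
      ℓ-nonTrivial = prime⇒nonTrivial ℓ-prime
    P : ℕ → Set
    P m = .(NonZero m) → ∃[ e ] ∃[ r ] m ≡ ℓ ^ e * r × ¬ ℓ ∣ r
    step : ∀ m → (∀ {k} → k < m → P k) → P m
    step m rec m≢0 with ℓ ∣? m
    ... | no  ℓ∤m = 0 , m , sym (ℕ.+-identityʳ m) , ℓ∤m
    ... | yes ℓ∣m with rec (quotient-< ℓ∣m {{ℓ-nonTrivial}} {{m≢0}}) (quotient≢0 ℓ∣m {{m≢0}})
    ...   | e , r , eq , ℓ∤r =
      suc e , r , trans (m∣n⇒n≡m*quotient ℓ∣m) (trans (cong (ℓ *_) eq) (sym (ℕ.*-assoc ℓ (ℓ ^ e) r))) , ℓ∤r

  prime∤⇒coprime : ∀ {ℓ m} → Prime ℓ → ¬ ℓ ∣ m → Coprime ℓ m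
  prime∤⇒coprime ℓ-prime ℓ∤m (d∣ℓ , d∣m) with prime⇒irreducible ℓ-prime d∣ℓ
  ... | inj₁ d≡1 = d≡1
  ... | inj₂ refl = contradiction d∣m ℓ∤m

  ∣∧<⇒≡0 : ∀ {m d} → m ∣ d → d < m → d ≡ 0
  ∣∧<⇒≡0 {d = zero}  _   _   = refl
  ∣∧<⇒≡0 {d = suc _} m∣d d<m = contradiction (∣⇒≤ m∣d) (ℕ.<⇒≱ d<m)

  coprime-* : ∀ {k l m} → Coprime k m → Coprime l m → Coprime (k * l) m
  coprime-* {k} {l} k⊥m l⊥m (d∣kl , d∣m) =
    l⊥m (coprime-divisor (λ (e∣d , e∣k) → k⊥m (e∣k , ∣-trans e∣d d∣m)) d∣kl , d∣m)

  coprime-^ : ∀ {k m} → Coprime k m → ∀ e → Coprime (k ^ e) m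
  coprime-^ k⊥m zero    (d∣1 , _) = ∣1⇒≡1 d∣1
  coprime-^ k⊥m (suc e) = coprime-* k⊥m (coprime-^ k⊥m e)

  coprime-*-∣ : ∀ {k m i} → Coprime k m → k ∣ i → m ∣ i → k * m ∣ i
  coprime-*-∣ {k} {m} k⊥m (divides q refl) m∣qk =
    subst (k * m ∣_) (ℕ.*-comm k q)
      (*-monoʳ-∣ k (coprime-divisor (λ (d∣m , d∣k) → k⊥m (d∣k , d∣m)) (subst (m ∣_) (ℕ.*-comm q k) m∣qk)))

  prime∣!⇒≤ : ∀ {p} → Prime p → ∀ k → p ∣ k ! → p ≤ k
  prime∣!⇒≤ p-prime zero    p∣1 = contradiction (subst Prime (∣1⇒≡1 p∣1) p-prime) ¬prime[1]
  prime∣!⇒≤ p-prime (suc k) p∣ with euclidsLemma (suc k) (k !) p-prime p∣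
  ... | inj₁ p∣1+k = ∣⇒≤ p∣1+k
  ... | inj₂ p∣k!  = ℕ.m≤n⇒m≤1+n (prime∣!⇒≤ p-prime k p∣k!)

  -- `p` divides `p !`, which is the binomial coefficient times two factorials of numbers below `p`,
  -- and it divides neither factorial.
  prime∣C : ∀ {p} → Prime p → ∀ {k} → 0 < k → k < p → p ∣ (p C k)
  prime∣C {p@(suc p-1)} p-prime {k} 0<k k<p with euclidsLemma (p C k) (k ! * (p ∸ k) !) p-prime p∣prod
    where
    k≤p = ℕ.<⇒≤ k<p
    instance
      nz = ℕ._!*_!≢0 k (p ∸ k)
    prod≡ : (p C k) * (k ! * (p ∸ k) !) ≡ p !
    prod≡ = trans (cong (_* (k ! * (p ∸ k) !)) (nCk≡n!/k![n-k]! k≤p)) (m/n*n≡m (k![n∸k]!∣n! k≤p))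
    p∣prod : p ∣ (p C k) * (k ! * (p ∸ k) !)
    p∣prod = subst (p ∣_) (sym prod≡) (m∣m*n (p-1 !))
  ... | inj₁ p∣C = p∣C
  ... | inj₂ p∣k![p∸k]! with euclidsLemma (k !) ((p ∸ k) !) p-prime p∣k![p∸k]!
  ...   | inj₁ p∣k!     = contradiction (prime∣!⇒≤ p-prime k p∣k!) (ℕ.<⇒≱ k<p)
  ...   | inj₂ p∣[p∸k]! = contradiction (prime∣!⇒≤ p-prime (p ∸ k) p∣[p∸k]!)
                            (ℕ.<⇒≱ (ℕ.∸-monoʳ-< 0<k (ℕ.<⇒≤ k<p)))

  -- A missed value could be punched out of the codomain, leaving an injection into a smaller set.
  injective⇒surjective : ∀ {k m} → m ≡ k → (f : Fin k → Fin m) → Injective _≡_ _≡_ f → ∀ y → ∃[ x ] f x ≡ y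
  injective⇒surjective {m = suc m} refl f f-inj y with Fin.any? (λ x → f x Fin.≟ y)
  ... | yes found = found
  ... | no  missed = contradiction
    (Fin.injective⇒≤ {f = λ x → punchOut (y≢f x)} (λ {i} {j} → f-inj ∘ Fin.punchOut-injective (y≢f i) (y≢f j)))
    (ℕ.<⇒≱ (ℕ.n<1+n m))
    where
    y≢f : ∀ x → y ≢ f x
    y≢f x eq = missed (x , sym eq)

  least : ∀ {ℓ} {P : ℕ → Set ℓ} → (∀ i → Dec (P i)) → ∀ {m} → P m → ∃[ s ] P s × (∀ t → P t → s ≤ t)
  least {P = P} P? {m} Pm = search m 0 (λ _ _ → z≤n) (subst P (sym (ℕ.+-identityʳ m)) Pm)
    where
    -- `k` is fuel, the distance from the candidate `i` to the known witness.
    search : ∀ k i → (∀ t → P t → i ≤ t) → P (k + i) → ∃[ s ] P s × (∀ t → P t → s ≤ t)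
    search zero    i below Pi = i , Pi , below
    search (suc k) i below P[k+i] with P? i
    ... | yes Pi = i , Pi , below
    ... | no ¬Pi = search k (suc i)
      (λ t Pt → ℕ.≤∧≢⇒< (below t Pt) λ { refl → ¬Pi Pt }) (subst P (sym (ℕ.+-suc k i)) P[k+i])

funToFin-cong : ∀ {m n} {f g : Fin m → Fin n} → f ≗ g → funToFin f ≡ funToFin g
funToFin-cong {zero}  f≗g = ≡.refl
funToFin-cong {suc m} f≗g = ≡.cong₂ combine (f≗g zero) (funToFin-cong (f≗g ∘ suc))

finToFun-injective : ∀ {m n} {j k : Fin (n ℕ.^ m)} → finToFun {n} {m} j ≗ finToFun k → j ≡ k
finToFun-injective {m} {n} {j} {k} eq =
  ≡.trans (≡.sym (Fin.funToFin-finToFin {m} {n} j)) (≡.trans (funToFin-cong eq) (Fin.funToFin-finToFin {m} {n} k))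

bounded : ∀ {k} (f : Fin k → ℕ) → ∃[ s ] (∀ i → f i ≤ s)
bounded {zero}  f = 0 , λ ()
bounded {suc k} f = let s , f≤s = bounded (f ∘ suc) in
  f zero ℕ.⊔ s , λ { zero → ℕ.m≤m⊔n (f zero) s ; (suc i) → ℕ.≤-trans (f≤s i) (ℕ.m≤n⊔m (f zero) s) }

-- Primitive divisors

module _ {N p m : ℕ} (p-prime : Prime p) .{{_ : NonZero m}} (N-primitive : IsPrimitiveDivisor N p m) where

  private
    instance
      p≢0 = prime⇒nonZero p-prime

  primitiveDivisor-coprime : Coprime N p
  primitiveDivisor-coprime {d} (d∣N , d∣p) = ∣1⇒≡1 (∣m+n∣m⇒∣n
    (≡.subst (d ∣_) (≡.sym (ℕ.m∸n+n≡m (ℕ.m^n>0 p m))) (∣-trans d∣p (p∣p^ m)))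
    (∣-trans d∣N (proj₁ N-primitive)))
    where
    p∣p^ : ∀ j → .{{NonZero j}} → p ∣ p ℕ.^ j
    p∣p^ (suc j) = m∣m*n (p ℕ.^ j)

  -- The difference is p^i (p^(j-i) - 1) and `N` is prime to `p`, so a positive j - i would
  -- contradict primitivity. Such differences arise when the conjugates x^(p^i) and x^(p^j) of an
  -- element of order `N` coincide.
  primitiveDivisor-∸ : ∀ {i j} → i ≤ j → j < m → N ∣ p ℕ.^ j ℕ.∸ p ℕ.^ i → i ≡ j
  primitiveDivisor-∸ {i} {j} i≤j j<m N∣ with j ℕ.∸ i in eq
  ... | zero  = ℕ.≤-antisym i≤j (ℕ.m∸n≡0⇒m≤n eq)
  ... | suc d = contradiction (coprime-divisor (Coprimality.sym (coprime-^ (Coprimality.sym primitiveDivisor-coprime) i)) N∣′)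
                  (proj₂ N-primitive (suc d) (s≤s z≤n) (≡.subst (_< m) eq (ℕ.≤-<-trans (ℕ.m∸n≤m j i) j<m)))
    where
    N∣′ : N ∣ p ℕ.^ i ℕ.* (p ℕ.^ suc d ℕ.∸ 1)
    N∣′ = ≡.subst (N ∣_) (begin
      p ℕ.^ j ℕ.∸ p ℕ.^ i
        ≡⟨ ≡.cong (λ k → p ℕ.^ k ℕ.∸ p ℕ.^ i) (≡.trans (≡.sym (ℕ.m+[n∸m]≡n i≤j)) (≡.cong (i ℕ.+_) eq)) ⟩
      p ℕ.^ (i ℕ.+ suc d) ℕ.∸ p ℕ.^ i
        ≡⟨ ≡.cong₂ ℕ._∸_ (ℕ.^-distribˡ-+-* p i (suc d)) (≡.sym (ℕ.*-identityʳ (p ℕ.^ i))) ⟩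
      p ℕ.^ i ℕ.* p ℕ.^ suc d ℕ.∸ p ℕ.^ i ℕ.* 1
        ≡⟨ ℕ.*-distribˡ-∸ (p ℕ.^ i) (p ℕ.^ suc d) 1 ⟨
      p ℕ.^ i ℕ.* (p ℕ.^ suc d ℕ.∸ 1)
        ∎) N∣
      where open ≡.≡-Reasoning

-- A list of exponents stands for the polynomial that is the sum of the corresponding powers of X.

infixl 7 _⊗_
_⊗_ : List ℕ → List ℕ → List ℕ
[]      ⊗ js = []
(i ∷ l) ⊗ js = map (i ℕ.+_) js ++ l ⊗ js

infixr 8 _↑_
_↑_ : List ℕ → ℕ → List ℕ
l ↑ zero  = 0 ∷ []
l ↑ suc k = l ⊗ (l ↑ k)

-- The constant p − 1 is −1 in characteristic p.
neg : ℕ → List ℕ → List ℕ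
neg p l = replicate (p ℕ.∸ 1) 0 ⊗ l

-- The i-th list of split b l holds the exponents q with i + b q in l, so that a polynomial becomes
-- Σ X^i Pᵢ(X^b) with i < b; join b goes back.
push : ℕ → ℕ → List (List ℕ) → List (List ℕ)
push r       q []       = []
push zero    q (l ∷ ls) = (q ∷ l) ∷ ls
push (suc r) q (l ∷ ls) = l ∷ push r q ls

split : (b : ℕ) → .{{NonZero b}} → List ℕ → List (List ℕ)
split b []      = replicate b []
split b (i ∷ l) = push (i ℕ.% b) (i ℕ./ b) (split b l)

join : ℕ → List (List ℕ) → List ℕ
join b []       = []
join b (l ∷ ls) = map (b ℕ.*_) l ++ map suc (join b ls)

length-push : ∀ r q ls → length (push r q ls) ≡ length ls
length-push r       q []       = ≡.refl
length-push zero    q (l ∷ ls) = ≡.refl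
length-push (suc r) q (l ∷ ls) = ≡.cong suc (length-push r q ls)

length-split : ∀ b .{{_ : NonZero b}} l → length (split b l) ≡ b
length-split b []      = length-replicate b
length-split b (i ∷ l) = ≡.trans (length-push (i ℕ.% b) (i ℕ./ b) (split b l)) (length-split b l)

-- Only an inequality, since `push` discards the exponent when `r` runs past the end of `ls`.
sum-push : ∀ r q ls → sum (map length (push r q ls)) ≤ suc (sum (map length ls))
sum-push r       q []       = z≤n
sum-push zero    q (l ∷ ls) = ℕ.≤-refl
sum-push (suc r) q (l ∷ ls) =
  ℕ.≤-trans (ℕ.+-monoʳ-≤ (length l) (sum-push r q ls)) (ℕ.≤-reflexive (ℕ.+-suc (length l) _))

sum-split : ∀ b .{{_ : NonZero b}} l → sum (map length (split b l)) ≤ length l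
sum-split b []      = ℕ.≤-reflexive (empty b)
  where
  empty : ∀ b → sum (map length (replicate b [])) ≡ 0
  empty zero    = ≡.refl
  empty (suc b) = empty b
sum-split b (i ∷ l) = ℕ.≤-trans (sum-push (i ℕ.% b) (i ℕ./ b) (split b l)) (s≤s (sum-split b l))

length-join : ∀ b ls → length (join b ls) ≡ sum (map length ls)
length-join b []       = ≡.refl
length-join b (l ∷ ls) = ≡.trans (length-++ (map (b ℕ.*_) l))
  (≡.cong₂ ℕ._+_ (length-map (b ℕ.*_) l) (≡.trans (length-map suc (join b ls)) (length-join b ls)))

sum-map≤ : ∀ {g} (ls : List (List ℕ)) → All (λ l → length l ≤ g) ls → sum (map length ls) ≤ length ls ℕ.* g
sum-map≤ []       []         = z≤n
sum-map≤ (l ∷ ls) (le ∷ les) = ℕ.+-mono-≤ le (sum-map≤ ls les)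

-- Pigeonhole; the predicate is carried along so that the short list comes with a record of what it
-- represents.
below-average : ∀ {ℓ} {P : List ℕ → Set ℓ} {g ls} → All P ls → sum (map length ls) < length ls ℕ.* g →
                ∃[ l ] length l < g × P l
below-average {P = P} {g} {l ∷ ls} (Pl ∷ Pls) lt with length l ℕ.<? g
... | yes l<g = l , l<g , Pl
... | no  l≮g = below-average {P = P} {ls = ls} Pls (ℕ.≰⇒> λ ge → ℕ.<⇒≱ lt (ℕ.+-mono-≤ (ℕ.≮⇒≥ l≮g) ge))

-- Finite fields, with `n` the order of the multiplicative group

module FiniteField {k₁ k₂ k₃} (F : HeytingField k₁ k₂ k₃) (n : ℕ) (order : HasOrder F (suc n)) where

  open HeytingField F using (_#_; tight; #⇒invertible; #-irrefl; heytingCommutativeRing)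
  commutativeRing = HeytingCommutativeRing.commutativeRing heytingCommutativeRing
  open CommutativeRing commutativeRing public hiding (zero)
  open SemiringExp semiring public
  open CommutativeSemiringExp commutativeSemiring public using (^-distrib-*)
  open SemiringMult semiring public using (×-assoc-*; ×1-homo-*; ×-homo-+; ×-congʳ) renaming (_×_ to _·_)
  open RingProperties ring using (-0#≈0#; -‿injective; +-cancelˡ)
  open import Algebra.Solver.Ring.NaturalCoefficients.Default commutativeSemiring using (solve; _:=_; _:+_; _:*_)
  open import Relation.Binary.Reasoning.Setoid setoid

  index : Carrier → Fin (suc n)
  index = Inverse.to order

  elem : Fin (suc n) → Carrier
  elem = Inverse.from order

  elem-index : ∀ x → elem (index x) ≈ x
  elem-index x = Inverse.inverseʳ order ≡.refl

  index-elem : ∀ i → index (elem i) ≡ i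
  index-elem i = Inverse.inverseˡ order refl

  index-injective : ∀ {x y} → index x ≡ index y → x ≈ y
  index-injective {x} {y} eq = trans (sym (elem-index x)) (trans (reflexive (≡.cong elem eq)) (elem-index y))

  elem-injective : ∀ {i j} → elem i ≈ elem j → i ≡ j
  elem-injective {i} {j} eq =
    ≡.trans (≡.sym (index-elem i)) (≡.trans (Inverse.to-cong order eq) (index-elem j))

  infix 4 _≟_
  _≟_ : ∀ x y → Dec (x ≈ y)
  x ≟ y = map′ index-injective (Inverse.to-cong order) (index x Fin.≟ index y)

  module _ {ℓ} {P : Carrier → Set ℓ} (resp : ∀ {x y} → x ≈ y → P x → P y) (P? : ∀ x → Dec (P x)) where

    any? : Dec (∃ P)
    any? = map′ (λ (i , Pi) → elem i , Pi) (λ (x , Px) → index x , resp (sym (elem-index x)) Px)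
                (Fin.any? (P? ∘ elem))

    all? : Dec (∀ x → P x)
    all? = map′ (λ Pe x → resp (elem-index x) (Pe (index x))) (λ P x → P (elem x))
                (Fin.all? (P? ∘ elem))

  1≉0 : ¬ 1# ≈ 0#
  1≉0 eq = #-irrefl eq (HeytingCommutativeRingProperties.1#0 heytingCommutativeRing)

  -- Tightness only shows that `x` cannot fail to be apart from zero; the finite search turns this
  -- into an actual inverse.
  inverse : ∀ {x} → ¬ x ≈ 0# → ∃[ y ] y * x ≈ 1#
  inverse {x} x≉0 with any? {P = λ y → y * x ≈ 1#} (λ eq → trans (*-congʳ (sym eq))) (λ y → y * x ≟ 1#)
  ... | yes inv = inv
  ... | no ¬inv = contradiction (proj₁ (tight x 0#) ¬x#0) x≉0
    where
    ¬x#0 : ¬ x # 0#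
    ¬x#0 x#0 = let y , eq , _ = #⇒invertible x#0 in
      ¬inv (y , trans (*-congˡ (sym (trans (+-congˡ -0#≈0#) (+-identityʳ x)))) eq)

  *-cancelˡ : ∀ {x y z} → ¬ x ≈ 0# → x * y ≈ x * z → y ≈ z
  *-cancelˡ {x} {y} {z} x≉0 eq = let w , wx = inverse x≉0 in begin
    y            ≈⟨ *-identityˡ y ⟨
    1# * y       ≈⟨ *-congʳ wx ⟨
    w * x * y    ≈⟨ *-assoc w x y ⟩
    w * (x * y)  ≈⟨ *-congˡ eq ⟩
    w * (x * z)  ≈⟨ *-assoc w x z ⟨
    w * x * z    ≈⟨ *-congʳ wx ⟩
    1# * z       ≈⟨ *-identityˡ z ⟩
    z            ∎

  *-zero⇒ : ∀ {x y} → x * y ≈ 0# → ¬ x ≈ 0# → y ≈ 0#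
  *-zero⇒ {x} xy≈0 x≉0 = *-cancelˡ x≉0 (trans xy≈0 (sym (zeroʳ x)))

  *-nonZero : ∀ {x y} → ¬ x ≈ 0# → ¬ y ≈ 0# → ¬ x * y ≈ 0#
  *-nonZero x≉0 y≉0 xy≈0 = y≉0 (*-zero⇒ xy≈0 x≉0)

  ^-nonZero : ∀ {x} → ¬ x ≈ 0# → ∀ i → ¬ x ^ i ≈ 0#
  ^-nonZero x≉0 zero    = 1≉0
  ^-nonZero x≉0 (suc i) = *-nonZero x≉0 (^-nonZero x≉0 i)

  ^-zero⇒ : ∀ {x} i → x ^ i ≈ 0# → x ≈ 0#
  ^-zero⇒ {x} i eq with x ≟ 0#
  ... | yes x≈0 = x≈0
  ... | no  x≉0 = contradiction eq (^-nonZero x≉0 i)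

  1^ : ∀ i → 1# ^ i ≈ 1#
  1^ zero    = refl
  1^ (suc i) = trans (*-identityˡ _) (1^ i)

  0^ : ∀ i → .{{NonZero i}} → 0# ^ i ≈ 0#
  0^ (suc i) = zeroˡ _

  x-y≈0⇒x≈y : ∀ {x y} → x - y ≈ 0# → x ≈ y
  x-y≈0⇒x≈y {x} {y} eq = begin
    x            ≈⟨ +-identityʳ x ⟨
    x + 0#       ≈⟨ +-congˡ (-‿inverseˡ y) ⟨
    x + (- y + y) ≈⟨ +-assoc x (- y) y ⟨
    x - y + y    ≈⟨ +-congʳ eq ⟩
    0# + y       ≈⟨ +-identityˡ y ⟩
    y            ∎

  bijection : (f g : Carrier → Carrier) → (∀ {x y} → x ≈ y → f x ≈ f y) → (∀ {x y} → x ≈ y → g x ≈ g y) →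
              (∀ x → f (g x) ≈ x) → (∀ x → g (f x) ≈ x) → Permutation (suc n) (suc n)
  bijection f g f-cong g-cong fg gf = permutation (index ∘ f ∘ elem) (index ∘ g ∘ elem)
    (λ i → ≡.trans (Inverse.to-cong order (trans (f-cong (elem-index _)) (fg _))) (index-elem i))
    (λ i → ≡.trans (Inverse.to-cong order (trans (g-cong (elem-index _)) (gf _))) (index-elem i))

  -- Sums and products over the whole field

  private
    module Σ = CommutativeMonoidSum +-commutativeMonoid
    module Π = CommutativeMonoidSum *-commutativeMonoid

  -- Translation by `1#` permutes the field, so it leaves the sum of all elements unchanged while
  -- adding `1#` to each term.
  card·1≈0 : suc n · 1# ≈ 0#
  card·1≈0 = +-cancelˡ (Σ.sum elem) _ _ (begin
    Σ.sum elem + suc n · 1#                  ≈⟨ +-congˡ (Σ.sum-replicate (suc n)) ⟨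
    Σ.sum elem + Σ.sum {suc n} (λ _ → 1#)     ≈⟨ Σ.∑-distrib-+ elem (λ _ → 1#) ⟨
    Σ.sum (λ i → elem i + 1#)                ≈⟨ Σ.sum-cong-≋ {suc n} (λ i → sym (elem-index (elem i + 1#))) ⟩
    Σ.sum (λ i → elem (shift ⟨$⟩ʳ i))          ≈⟨ Σ.sum-permute elem shift ⟨
    Σ.sum elem                               ≈⟨ +-identityʳ _ ⟨
    Σ.sum elem + 0#                          ∎)
    where
    shift = bijection (_+ 1#) (_- 1#) +-congʳ +-congʳ
      (λ x → trans (+-assoc x _ _) (trans (+-congˡ (-‿inverseˡ 1#)) (+-identityʳ x)))
      (λ x → trans (+-assoc x _ _) (trans (+-congˡ (-‿inverseʳ 1#)) (+-identityʳ x)))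

  unit : Fin n → Carrier
  unit = elem ∘ punchIn (index 0#)

  unit-nonZero : ∀ i → ¬ unit i ≈ 0#
  unit-nonZero i eq = Fin.punchInᵢ≢i (index 0#) i (elem-injective (trans eq (sym (elem-index 0#))))

  unit-injective : ∀ {i j} → unit i ≈ unit j → i ≡ j
  unit-injective = Fin.punchIn-injective (index 0#) _ _ ∘ elem-injective

  private
    -- Replacing the factor 0 by 1 lets the product over the units be taken over the whole field.
    patch : Carrier → Carrier → Carrier
    patch y x with x ≟ 0#
    ... | yes _ = 1#
    ... | no  _ = y

    patch-zero : ∀ {x y} → x ≈ 0# → patch y x ≈ 1#
    patch-zero {x} x≈0 with x ≟ 0#
    ... | yes _   = refl
    ... | no  x≉0 = contradiction x≈0 x≉0

    patch-nonZero : ∀ {x y} → ¬ x ≈ 0# → patch y x ≈ y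
    patch-nonZero {x} x≉0 with x ≟ 0#
    ... | yes x≈0 = contradiction x≈0 x≉0
    ... | no  _   = refl

    prod-patch : (f : Carrier → Carrier) →
                 Π.sum (λ i → patch (f (elem i)) (elem i)) ≈ Π.sum (f ∘ unit)
    prod-patch f = begin
      Π.sum (λ i → patch (f (elem i)) (elem i))
        ≈⟨ Π.sum-remove {i = index 0#} (λ i → patch (f (elem i)) (elem i)) ⟩
      patch (f (elem (index 0#))) (elem (index 0#)) * Π.sum (λ i → patch (f (unit i)) (unit i))
        ≈⟨ *-cong (patch-zero (elem-index 0#)) (Π.sum-cong-≋ (patch-nonZero ∘ unit-nonZero)) ⟩
      1# * Π.sum (f ∘ unit)
        ≈⟨ *-identityˡ _ ⟩
      Π.sum (f ∘ unit)
        ∎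

    prod-nonZero : ∀ {m} (f : Fin m → Carrier) → (∀ i → ¬ f i ≈ 0#) → ¬ Π.sum f ≈ 0#
    prod-nonZero {zero}  f f≉0 = 1≉0
    prod-nonZero {suc m} f f≉0 = *-nonZero (f≉0 zero) (prod-nonZero (f ∘ suc) (f≉0 ∘ suc))

  -- Multiplication by `x` permutes the units, so their product absorbs the factor x^n.
  fermat : ∀ {x} → ¬ x ≈ 0# → x ^ n ≈ 1#
  fermat {x} x≉0 = *-cancelˡ (prod-nonZero unit unit-nonZero) (begin
    Π.sum unit * x ^ n                          ≈⟨ *-comm _ _ ⟩
    x ^ n * Π.sum unit                          ≈⟨ *-congʳ (Π.sum-replicate n) ⟨
    Π.sum {n} (λ _ → x) * Π.sum unit            ≈⟨ Π.∑-distrib-+ (λ _ → x) unit ⟨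
    Π.sum (λ i → x * unit i)                    ≈⟨ prod-patch (x *_) ⟨
    Π.sum (λ i → patch (x * elem i) (elem i))   ≈⟨ Π.sum-cong-≋ (λ i → step (elem i)) ⟩
    Π.sum (λ i → patch (elem (scale ⟨$⟩ʳ i)) (elem (scale ⟨$⟩ʳ i)))
                                                ≈⟨ Π.sum-permute (λ i → patch (elem i) (elem i)) scale ⟨
    Π.sum (λ i → patch (elem i) (elem i))       ≈⟨ prod-patch id ⟩
    Π.sum unit                                  ≈⟨ *-identityʳ _ ⟨
    Π.sum unit * 1#                             ∎)
    where
    y = proj₁ (inverse x≉0)
    yx = proj₂ (inverse x≉0)
    scale = bijection (x *_) (y *_) *-congˡ *-congˡ
      (λ z → trans (sym (*-assoc x y z)) (trans (*-congʳ (trans (*-comm x y) yx)) (*-identityˡ z)))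
      (λ z → trans (sym (*-assoc y x z)) (trans (*-congʳ yx) (*-identityˡ z)))
    step : ∀ z → patch (x * z) z ≈ patch (elem (index (x * z))) (elem (index (x * z)))
    step z with z ≟ 0#
    ... | yes z≈0 = sym (patch-zero (trans (elem-index _) (trans (*-congˡ z≈0) (zeroʳ x))))
    ... | no  z≉0 = sym (trans (patch-nonZero (*-nonZero x≉0 z≉0 ∘ trans (sym (elem-index _)))) (elem-index _))

  -- Polynomials and their roots

  -- A list of coefficients stands for a polynomial, the head being the constant coefficient.
  eval : List Carrier → Carrier → Carrier
  eval []       x = 0#
  eval (c ∷ cs) x = c + x * eval cs x

  eval-cong : ∀ cs {x y} → x ≈ y → eval cs x ≈ eval cs y
  eval-cong []       x≈y = refl
  eval-cong (c ∷ cs) x≈y = +-congˡ (*-cong x≈y (eval-cong cs x≈y))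

  private
    -- Horner's scheme: the quotient of `c ∷ cs` by X - r has as coefficients the values at `r` of
    -- the successive tails, beginning with `cs`. The constant `c` enters only the remainder, hence
    -- the argument is the tail.
    quot : Carrier → List Carrier → List Carrier
    quot r []       = []
    quot r (c ∷ cs) = eval (c ∷ cs) r ∷ quot r cs

    quot-length : ∀ r cs → length (quot r cs) ≡ length cs
    quot-length r []       = ≡.refl
    quot-length r (c ∷ cs) = ≡.cong suc (quot-length r cs)

    -- p(x) − p(r) = (x − r) q(x), with both sides moved so that no subtraction occurs.
    division : ∀ c cs x r → eval (c ∷ cs) x + r * eval (quot r cs) x ≈ eval (c ∷ cs) r + x * eval (quot r cs) x
    division c []       x r = +-cong (+-congˡ (trans (zeroʳ x) (sym (zeroʳ r)))) (trans (zeroʳ r) (sym (zeroʳ x)))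
    division c (d ∷ cs) x r = begin
      (c + x * Ex) + r * (Er + x * Q)
        ≈⟨ solve 6 (λ c x Ex r Er Q → (c :+ x :* Ex) :+ r :* (Er :+ x :* Q) :=
                                      (c :+ r :* Er) :+ x :* (Ex :+ r :* Q)) refl c x Ex r Er Q ⟩
      (c + r * Er) + x * (Ex + r * Q)
        ≈⟨ +-congˡ (*-congˡ (division d cs x r)) ⟩
      (c + r * Er) + x * (Er + x * Q)
        ∎
      where
      Ex = eval (d ∷ cs) x
      Er = eval (d ∷ cs) r
      Q  = eval (quot r cs) x

  eval-zero : ∀ {cs} → All (_≈ 0#) cs → ∀ x → eval cs x ≈ 0#
  eval-zero []           x = refl
  eval-zero (c≈0 ∷ cs≈0) x = trans (+-cong c≈0 (trans (*-congˡ (eval-zero cs≈0 x)) (zeroʳ x))) (+-identityˡ 0#)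

  private
    constant-zero : ∀ {c cs} r → All (_≈ 0#) cs → eval (c ∷ cs) r ≈ 0# → c ≈ 0#
    constant-zero {c} {cs} r cs≈0 eq = begin
      c                   ≈⟨ +-identityʳ c ⟨
      c + 0#              ≈⟨ +-congˡ (trans (*-congˡ (eval-zero cs≈0 r)) (zeroʳ r)) ⟨
      c + r * eval cs r   ≈⟨ eq ⟩
      0#                  ∎

    quot-zero : ∀ r cs → All (_≈ 0#) (quot r cs) → All (_≈ 0#) cs
    quot-zero r []       _ = []
    quot-zero r (c ∷ cs) (c≈0 ∷ cs≈0) = let cs≈0′ = quot-zero r cs cs≈0 in constant-zero r cs≈0′ c≈0 ∷ cs≈0′

  -- Length at most `k` means degree below `k`. After division by X - r₀ the other roots, being
  -- different from r₀, are roots of the quotient; once the quotient vanishes, so do the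
  -- coefficients, from the last one back to the constant.
  roots⇒zero : ∀ {k} (cs : List Carrier) → length cs ≤ k → (r : Fin k → Carrier) →
               Injective _≡_ _≈_ r → (∀ i → eval cs (r i) ≈ 0#) → All (_≈ 0#) cs
  roots⇒zero [] _ _ _ _ = []
  roots⇒zero {suc k} (c ∷ cs) (s≤s le) r r-inj zeros = constant-zero r₀ cs≈0 (zeros zero) ∷ cs≈0
    where
    r₀ = r zero
    quot-root : ∀ i → eval (quot r₀ cs) (r (suc i)) ≈ 0#
    quot-root i with eval (quot r₀ cs) (r (suc i)) ≟ 0#
    ... | yes Q≈0 = Q≈0
    ... | no  Q≉0 = contradiction (r-inj (*-cancelˡ Q≉0 eq)) λ ()
      where
      x = r (suc i)
      Q = eval (quot r₀ cs) x
      eq : Q * r₀ ≈ Q * x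
      eq = begin
        Q * r₀                      ≈⟨ *-comm Q r₀ ⟩
        r₀ * Q                      ≈⟨ +-identityˡ _ ⟨
        0# + r₀ * Q                 ≈⟨ +-congʳ (zeros (suc i)) ⟨
        eval (c ∷ cs) x + r₀ * Q    ≈⟨ division c cs x r₀ ⟩
        eval (c ∷ cs) r₀ + x * Q    ≈⟨ +-congʳ (zeros zero) ⟩
        0# + x * Q                  ≈⟨ +-identityˡ _ ⟩
        x * Q                       ≈⟨ *-comm x Q ⟩
        Q * x                       ∎
    cs≈0 = quot-zero r₀ cs (roots⇒zero (quot r₀ cs) (ℕ.≤-trans (ℕ.≤-reflexive (quot-length r₀ cs)) le)
                              (r ∘ suc) (Fin.suc-injective ∘ r-inj) quot-root)

  monomial : ℕ → List Carrier
  monomial m = replicate m 0# ++ 1# ∷ []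

  eval-monomial : ∀ m x → eval (monomial m) x ≈ x ^ m
  eval-monomial zero    x = trans (+-congˡ (zeroʳ x)) (+-identityʳ 1#)
  eval-monomial (suc m) x = trans (+-identityˡ _) (*-congˡ (eval-monomial m x))

  unity-roots≤ : ∀ {k m} → .{{NonZero m}} → (r : Fin k → Carrier) → Injective _≡_ _≈_ r →
                 (∀ i → r i ^ m ≈ 1#) → k ≤ m
  unity-roots≤ {k} {suc m} r r-inj r^m≈1 = ℕ.≮⇒≥ λ m<k → case-zero (roots⇒zero poly (le m<k) r r-inj root)
    where
    -- This is X^(m+1) - 1 for the inner `m`; its nonzero constant coefficient gives the
    -- contradiction.
    poly = - 1# ∷ monomial m
    le : suc m < k → length poly ≤ k
    le = ℕ.≤-trans (ℕ.≤-reflexive (≡.cong suc (≡.trans (length-++ (replicate m 0#))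
           (≡.trans (≡.cong (ℕ._+ 1) (length-replicate m)) (ℕ.+-comm m 1)))))
    root : ∀ i → eval poly (r i) ≈ 0#
    root i = trans (+-congˡ (trans (*-congˡ (eval-monomial m (r i))) (r^m≈1 i))) (-‿inverseˡ 1#)
    case-zero : ¬ All (_≈ 0#) poly
    case-zero (-1≈0 ∷ _) = 1≉0 (-‿injective (trans -1≈0 (sym -0#≈0#)))

  -- Multiplicative orders

  IsOrder : Carrier → ℕ → Set _
  IsOrder x m = x ^ m ≈ 1# × (∀ i → x ^ i ≈ 1# → m ∣ i)

  ^-∣ : ∀ {x m i} → x ^ m ≈ 1# → m ∣ i → x ^ i ≈ 1#
  ^-∣ {x} {m} x^m≈1 (divides q ≡.refl) = begin
    x ^ (q ℕ.* m)   ≡⟨ ≡.cong (x ^_) (ℕ.*-comm q m) ⟩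
    x ^ (m ℕ.* q)   ≈⟨ ^-assocʳ x m q ⟨
    (x ^ m) ^ q     ≈⟨ ^-congˡ q x^m≈1 ⟩
    1# ^ q          ≈⟨ 1^ q ⟩
    1#              ∎

  order-nonZero : ∀ {x m} → .{{NonZero m}} → x ^ m ≈ 1# → ¬ x ≈ 0#
  order-nonZero {x} {m} x^m≈1 x≈0 = 1≉0 (trans (sym x^m≈1) (trans (^-congˡ m x≈0) (0^ m)))

  ^-cancel : ∀ {x i j} → ¬ x ≈ 0# → i ≤ j → x ^ i ≈ x ^ j → x ^ (j ℕ.∸ i) ≈ 1#
  ^-cancel {x} {i} {j} x≉0 i≤j eq = *-cancelˡ (^-nonZero x≉0 i) (begin
    x ^ i * x ^ (j ℕ.∸ i)   ≈⟨ ^-homo-* x i (j ℕ.∸ i) ⟨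
    x ^ (i ℕ.+ (j ℕ.∸ i))   ≡⟨ ≡.cong (x ^_) (ℕ.m+[n∸m]≡n i≤j) ⟩
    x ^ j                   ≈⟨ eq ⟨
    x ^ i                   ≈⟨ *-identityʳ _ ⟨
    x ^ i * 1#              ∎)

  private
    powers-injective-≤ : ∀ {x m i j} → .{{NonZero m}} → IsOrder x m → i ≤ j → j < m → x ^ i ≈ x ^ j → i ≡ j
    powers-injective-≤ {x} {m} {i} {j} (x^m≈1 , m∣) i≤j j<m eq =
      ℕ.≤-antisym i≤j (ℕ.m∸n≡0⇒m≤n (∣∧<⇒≡0 (m∣ _ (^-cancel (order-nonZero x^m≈1) i≤j eq))
                                            (ℕ.≤-<-trans (ℕ.m∸n≤m j i) j<m)))

  powers-injective : ∀ {x m i j} → .{{NonZero m}} → IsOrder x m → i < m → j < m → x ^ i ≈ x ^ j → i ≡ j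
  powers-injective {i = i} {j} ord i<m j<m eq with ℕ.≤-total i j
  ... | inj₁ i≤j = powers-injective-≤ ord i≤j j<m eq
  ... | inj₂ j≤i = ≡.sym (powers-injective-≤ ord j≤i i<m (sym eq))

  -- The `m` distinct powers of `x` exhaust the roots of X^m - 1; any other `y` would be one root
  -- too many.
  unity⇒power : ∀ {x y m} → .{{NonZero m}} → IsOrder x m → y ^ m ≈ 1# → ∃[ u ] y ≈ x ^ u
  unity⇒power {x} {y} {m} ord y^m≈1 with Fin.any? {n = m} (λ u → y ≟ x ^ toℕ u)
  ... | yes (u , eq) = toℕ u , eq
  ... | no  none     = contradiction (unity-roots≤ r r-inj r^m≈1) (ℕ.<⇒≱ (ℕ.n<1+n m))
    where
    r : Fin (suc m) → Carrier
    r zero    = y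
    r (suc i) = x ^ toℕ i
    r-inj : Injective _≡_ _≈_ r
    r-inj {zero}  {zero}  _  = ≡.refl
    r-inj {zero}  {suc j} eq = contradiction (j , eq) none
    r-inj {suc i} {zero}  eq = contradiction (i , sym eq) none
    r-inj {suc i} {suc j} eq =
      ≡.cong suc (Fin.toℕ-injective (powers-injective ord (Fin.toℕ<n i) (Fin.toℕ<n j) eq))
    r^m≈1 : ∀ i → r i ^ m ≈ 1#
    r^m≈1 zero    = y^m≈1
    r^m≈1 (suc i) = trans (^-assocʳ x (toℕ i) m) (^-∣ (proj₁ ord) (n∣m*n (toℕ i)))

  order-^ : ∀ {x} k m → .{{NonZero k}} → IsOrder x (k ℕ.* m) → IsOrder (x ^ k) m
  order-^ {x} k m (x^km≈1 , km∣) =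
    trans (^-assocʳ x k m) x^km≈1 ,
    λ i eq → *-cancelˡ-∣ k (km∣ (k ℕ.* i) (trans (sym (^-assocʳ x k i)) eq))

  -- Raising (xy)^i = 1 to the power `m` removes `y`, so `k` divides i m and therefore i; likewise
  -- with the roles exchanged.
  order-* : ∀ {x y k m} → Coprime k m → IsOrder x k → IsOrder y m → IsOrder (x * y) (k ℕ.* m)
  order-* {x} {y} {k} {m} k⊥m (x^k≈1 , k∣) (y^m≈1 , m∣) =
    (begin
      (x * y) ^ (k ℕ.* m)             ≈⟨ ^-distrib-* x y (k ℕ.* m) ⟩
      x ^ (k ℕ.* m) * y ^ (k ℕ.* m)   ≈⟨ *-cong (^-∣ {x} {k} x^k≈1 (m∣m*n m)) (^-∣ {y} {m} y^m≈1 (n∣m*n k)) ⟩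
      1# * 1#                         ≈⟨ *-identityˡ 1# ⟩
      1#                              ∎) ,
    λ i eq → coprime-*-∣ k⊥m
      (coprime-divisor k⊥m (≡.subst (k ∣_) (ℕ.*-comm i m) (k∣ _ (isolate i eq y^m≈1))))
      (coprime-divisor (Coprimality.sym k⊥m) (≡.subst (m ∣_) (ℕ.*-comm i k)
        (m∣ _ (isolate i (trans (^-congˡ i (*-comm y x)) eq) x^k≈1))))
    where
    isolate : ∀ {x y m} i → (x * y) ^ i ≈ 1# → y ^ m ≈ 1# → x ^ (i ℕ.* m) ≈ 1#
    isolate {x} {y} {m} i eq y^m≈1 = begin
      x ^ (i ℕ.* m)                   ≈⟨ *-identityʳ _ ⟨
      x ^ (i ℕ.* m) * 1#              ≈⟨ *-congˡ (^-∣ y^m≈1 (n∣m*n i)) ⟨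
      x ^ (i ℕ.* m) * y ^ (i ℕ.* m)   ≈⟨ ^-distrib-* x y (i ℕ.* m) ⟨
      (x * y) ^ (i ℕ.* m)             ≈⟨ ^-assocʳ (x * y) i m ⟨
      ((x * y) ^ i) ^ m               ≈⟨ ^-congˡ m eq ⟩
      1# ^ m                          ≈⟨ 1^ m ⟩
      1#                              ∎

  coprime-unity : ∀ {y k m} → Coprime k m → y ^ k ≈ 1# → y ^ m ≈ 1# → y ≈ 1#
  coprime-unity {y} {k} {m} k⊥m y^k y^m with coprime-Bézout k⊥m
  ... | Bézout.+- a b eq = begin
    y                       ≈⟨ *-identityʳ y ⟨
    y * 1#                  ≈⟨ *-congˡ (^-∣ y^m (n∣m*n b)) ⟨
    y * y ^ (b ℕ.* m)       ≡⟨⟩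
    y ^ (1 ℕ.+ b ℕ.* m)     ≡⟨ ≡.cong (y ^_) eq ⟩
    y ^ (a ℕ.* k)           ≈⟨ ^-∣ y^k (n∣m*n a) ⟩
    1#                      ∎
  ... | Bézout.-+ a b eq = begin
    y                       ≈⟨ *-identityʳ y ⟨
    y * 1#                  ≈⟨ *-congˡ (^-∣ y^k (n∣m*n a)) ⟨
    y * y ^ (a ℕ.* k)       ≡⟨⟩
    y ^ (1 ℕ.+ a ℕ.* k)     ≡⟨ ≡.cong (y ^_) eq ⟩
    y ^ (b ℕ.* m)           ≈⟨ ^-∣ y^m (n∣m*n b) ⟩
    1#                      ∎

  -- Suppose y^i = 1. If ℓ does not divide i, coprimality forces y = 1; otherwise replace y by y^ℓ
  -- and divide i by ℓ.
  order-prime-power : ∀ {ℓ} → Prime ℓ → ∀ e {y} → ¬ y ^ (ℓ ℕ.^ e) ≈ 1# → y ^ (ℓ ℕ.^ suc e) ≈ 1# →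
                      IsOrder y (ℓ ℕ.^ suc e)
  order-prime-power {ℓ} ℓ-prime e {y} ≉1 ≈1 = ≈1 , λ i y^i≈1 → divide e ≉1 ≈1 i y^i≈1
    where
    instance
      ℓ≢0 = prime⇒nonZero ℓ-prime
    divide : ∀ e {y} → ¬ y ^ (ℓ ℕ.^ e) ≈ 1# → y ^ (ℓ ℕ.^ suc e) ≈ 1# → ∀ i → y ^ i ≈ 1# → ℓ ℕ.^ suc e ∣ i
    divide e {y} ≉1 ≈1 i y^i≈1 with ℓ ∣? i
    ... | no ℓ∤i = contradiction (trans (^-congˡ (ℓ ℕ.^ e) y≈1) (1^ (ℓ ℕ.^ e))) ≉1
      where
      y≈1 : y ≈ 1#
      y≈1 = coprime-unity (coprime-^ (prime∤⇒coprime ℓ-prime ℓ∤i) (suc e)) ≈1 y^i≈1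
    divide zero    {y} ≉1 ≈1 i y^i≈1 | yes ℓ∣i = ≡.subst (_∣ i) (≡.sym (ℕ.*-identityʳ ℓ)) ℓ∣i
    divide (suc e) {y} ≉1 ≈1 i y^i≈1 | yes (divides q ≡.refl) =
      ≡.subst (ℓ ℕ.^ suc (suc e) ∣_) (ℕ.*-comm ℓ q)
        (*-monoʳ-∣ ℓ (divide e {y ^ ℓ} (λ eq → ≉1 (trans (sym (^-assocʳ y ℓ (ℓ ℕ.^ e))) eq))
          (trans (^-assocʳ y ℓ (ℓ ℕ.^ suc e)) ≈1) q
          (trans (^-assocʳ y ℓ q) (trans (reflexive (≡.cong (y ^_) (ℕ.*-comm ℓ q))) y^i≈1))))

  instance
    n≢0 : NonZero n
    n≢0 = ℕ.≢-nonZero λ { ≡.refl → 1≉0 (index-injective (all-equal (index 1#) (index 0#))) }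
      where
      all-equal : (i j : Fin 1) → i ≡ j
      all-equal zero zero = ≡.refl

  non-unity : ∀ {m} → .{{NonZero m}} → m < n → ∃[ x ] ¬ x ≈ 0# × ¬ x ^ m ≈ 1#
  non-unity {m} m<n with Fin.any? (λ i → ¬? (unit i ^ m ≟ 1#))
  ... | yes (i , ≉1) = unit i , unit-nonZero i , ≉1
  ... | no  none = contradiction (unity-roots≤ unit unit-injective all-unity) (ℕ.<⇒≱ m<n)
    where
    all-unity : ∀ i → unit i ^ m ≈ 1#
    all-unity i with unit i ^ m ≟ 1#
    ... | yes eq = eq
    ... | no  ≉1 = contradiction (i , ≉1) none

  -- Split off from `m` the full power of one prime ℓ, treat the cofactor by induction, and multiply
  -- two elements of coprime orders. The case `m = n` supplies a primitive element.
  exists-order : ∀ m → m ∣ n → ∃[ x ] IsOrder x m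
  exists-order = <-rec (λ m → m ∣ n → ∃[ x ] IsOrder x m) step
    where
    step : ∀ m → (∀ {k} → k < m → k ∣ n → ∃[ x ] IsOrder x k) → m ∣ n → ∃[ x ] IsOrder x m
    step zero          _   0∣n = contradiction (0∣⇒≡0 0∣n) (ℕ.≢-nonZero⁻¹ n)
    step (suc zero)    _   _   = 1# , 1^ 1 , λ i _ → 1∣ i
    step m@(suc (suc _)) rec m∣n with prime-divisor {m} (s≤s (s≤s z≤n))
    ... | ℓ , ℓ-prime , ℓ∣m with remove-prime ℓ-prime m
    ...   | zero  , r , eq , ℓ∤r = contradiction (≡.subst (ℓ ∣_) (≡.trans eq (ℕ.+-identityʳ r)) ℓ∣m) ℓ∤r
    ...   | suc e , r , eq , ℓ∤r =
      y * x , ≡.subst (IsOrder (y * x)) (≡.sym eq) (order-* (coprime-^ (prime∤⇒coprime ℓ-prime ℓ∤r) (suc e)) y-order x-order)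
      where
      instance
        ℓ≢0 = prime⇒nonZero ℓ-prime
        ℓ-nonTrivial = prime⇒nonTrivial ℓ-prime
        ℓ^e≢0 = ℕ.m^n≢0 ℓ e
      ℓ^[1+e]∣m : ℓ ℕ.^ suc e ∣ m
      ℓ^[1+e]∣m = ≡.subst (ℓ ℕ.^ suc e ∣_) (≡.sym eq) (m∣m*n r)
      r∣m : r ∣ m
      r∣m = ≡.subst (r ∣_) (≡.sym eq) (n∣m*n (ℓ ℕ.^ suc e))
      r<m : r < m
      r<m = ℕ.≤∧≢⇒< (∣⇒≤ r∣m) λ { ≡.refl → ℓ∤r ℓ∣m }
      x = proj₁ (rec r<m (∣-trans r∣m m∣n))
      x-order = proj₂ (rec r<m (∣-trans r∣m m∣n))
      ℓ^[1+e]∣n = ∣-trans ℓ^[1+e]∣m m∣n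
      d = quotient ℓ^[1+e]∣n
      n≡ : n ≡ d ℕ.* (ℓ ℕ.* ℓ ℕ.^ e)
      n≡ = m∣n⇒n≡quotient*m ℓ^[1+e]∣n
      instance
        d≢0 = quotient≢0 ℓ^[1+e]∣n
        dℓ^e≢0 = ℕ.m*n≢0 d (ℓ ℕ.^ e)
      dℓ^e<n : d ℕ.* ℓ ℕ.^ e < n
      dℓ^e<n = ≡.subst (d ℕ.* ℓ ℕ.^ e <_) (≡.sym n≡)
        (ℕ.*-monoʳ-< d (≡.subst (ℓ ℕ.^ e <_) (ℕ.*-comm (ℓ ℕ.^ e) ℓ)
          (ℕ.m<m*n (ℓ ℕ.^ e) ℓ (ℕ.nonTrivial⇒n>1 ℓ))))
      -- Since d ℓ^e = n/ℓ, this `z` has z^(n/ℓ) different from 1 although z^n = 1, so `z ^ d` has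
      -- order exactly ℓ^(e+1).
      z = proj₁ (non-unity dℓ^e<n)
      z≉0 = proj₁ (proj₂ (non-unity dℓ^e<n))
      y = z ^ d
      y-order : IsOrder y (ℓ ℕ.^ suc e)
      y-order = order-prime-power ℓ-prime e
        (λ eq → proj₂ (proj₂ (non-unity dℓ^e<n)) (trans (sym (^-assocʳ z d (ℓ ℕ.^ e))) eq))
        (trans (^-assocʳ z d (ℓ ℕ.^ suc e)) (trans (reflexive (≡.cong (z ^_) (≡.sym n≡))) (fermat z≉0)))

-- Fields with p^m elements: the characteristic

module PrimePowerField {k₁ k₂ k₃} (F : HeytingField k₁ k₂ k₃) (n : ℕ) (order : HasOrder F (suc n))
                       {p m : ℕ} (p-prime : Prime p) (card : suc n ≡ p ℕ.^ m) where

  open FiniteField F n order public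
  open import Algebra.Solver.Ring.NaturalCoefficients.Default commutativeSemiring using (solve; _:=_; _:+_; _:*_)
  open import Relation.Binary.Reasoning.Setoid setoid
  open RingProperties ring using (-0#≈0#; +-cancelˡ; +-cancelʳ; -‿distribʳ-*; -‿+-comm; -‿involutive; -1*x≈-x)

  instance
    p≢0 : NonZero p
    p≢0 = prime⇒nonZero p-prime

  -- Its `m`-th power is the cardinality times `1#`, which is zero, and a field has no nilpotents.
  char·1≈0 : p · 1# ≈ 0#
  char·1≈0 = ^-zero⇒ m (begin
    (p · 1#) ^ m      ≈⟨ ·1-^ m ⟨
    (p ℕ.^ m) · 1#    ≡⟨ ≡.cong (_· 1#) card ⟨
    suc n · 1#        ≈⟨ card·1≈0 ⟩
    0#                ∎)
    where
    ·1-^ : ∀ j → (p ℕ.^ j) · 1# ≈ (p · 1#) ^ j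
    ·1-^ zero    = +-identityʳ 1#
    ·1-^ (suc j) = trans (×1-homo-* p (p ℕ.^ j)) (*-congˡ (·1-^ j))

  ∣⇒·1≈0 : ∀ {i} → p ∣ i → i · 1# ≈ 0#
  ∣⇒·1≈0 (divides q ≡.refl) = trans (×1-homo-* q p) (trans (*-congˡ char·1≈0) (zeroʳ _))

  ∣⇒·≈0 : ∀ {i} → p ∣ i → ∀ x → i · x ≈ 0#
  ∣⇒·≈0 {i} p∣i x = begin
    i · x           ≈⟨ ×-congʳ i (*-identityˡ x) ⟨
    i · (1# * x)    ≈⟨ ×-assoc-* i 1# x ⟨
    (i · 1#) * x    ≈⟨ *-congʳ (∣⇒·1≈0 p∣i) ⟩
    0# * x          ≈⟨ zeroˡ x ⟩
    0#              ∎

  -- Otherwise Bézout writes 1 as a combination of `p` and `i`. Divisibility by `p` is what carries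
  -- the vanishing of an integer from one field to the other.
  ·1≈0⇒∣ : ∀ i → i · 1# ≈ 0# → p ∣ i
  ·1≈0⇒∣ i i·1≈0 with p ∣? i
  ... | yes p∣i = p∣i
  ... | no  p∤i = contradiction 1·1≈0 (1≉0 ∘ trans (sym (+-identityʳ 1#)))
    where
    multiple : ∀ a {k} → k · 1# ≈ 0# → (a ℕ.* k) · 1# ≈ 0#
    multiple a {k} eq = trans (×1-homo-* a k) (trans (*-congˡ eq) (zeroʳ _))
    combination : ∀ {k l} → k · 1# ≈ 0# → 1 ℕ.+ k ≡ l → l · 1# ≈ 0# → 1 · 1# ≈ 0#
    combination {k} k≈0 ≡.refl l≈0 = begin
      1 · 1#            ≈⟨ +-identityʳ _ ⟨
      1 · 1# + 0#       ≈⟨ +-congˡ k≈0 ⟨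
      1 · 1# + k · 1#   ≈⟨ ×-homo-+ 1# 1 k ⟨
      (1 ℕ.+ k) · 1#    ≈⟨ l≈0 ⟩
      0#                ∎
    1·1≈0 : 1 · 1# ≈ 0#
    1·1≈0 with coprime-Bézout (prime∤⇒coprime p-prime p∤i)
    ... | Bézout.+- a b eq = combination (multiple b {i} i·1≈0) eq (multiple a {p} char·1≈0)
    ... | Bézout.-+ a b eq = combination (multiple a {p} char·1≈0) eq (multiple b {i} i·1≈0)

  private
    ·1-injective-≤ : ∀ {i j} → i ≤ j → j < p → i · 1# ≈ j · 1# → i ≡ j
    ·1-injective-≤ {i} {j} i≤j j<p eq =
      ℕ.≤-antisym i≤j (ℕ.m∸n≡0⇒m≤n (∣∧<⇒≡0 (·1≈0⇒∣ _ j∸i·1≈0) (ℕ.≤-<-trans (ℕ.m∸n≤m j i) j<p)))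
      where
      j∸i·1≈0 : (j ℕ.∸ i) · 1# ≈ 0#
      j∸i·1≈0 = +-cancelˡ (i · 1#) _ _ (begin
        i · 1# + (j ℕ.∸ i) · 1#    ≈⟨ ×-homo-+ 1# i (j ℕ.∸ i) ⟨
        (i ℕ.+ (j ℕ.∸ i)) · 1#     ≡⟨ ≡.cong (_· 1#) (ℕ.m+[n∸m]≡n i≤j) ⟩
        j · 1#                     ≈⟨ eq ⟨
        i · 1#                     ≈⟨ +-identityʳ _ ⟨
        i · 1# + 0#                ∎)

  ·1-injective : ∀ {i j} → i < p → j < p → i · 1# ≈ j · 1# → i ≡ j
  ·1-injective {i} {j} i<p j<p eq with ℕ.≤-total i j
  ... | inj₁ i≤j = ·1-injective-≤ i≤j j<p eq
  ... | inj₂ j≤i = ≡.sym (·1-injective-≤ j≤i i<p (sym eq))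

  -- Frobenius

  IsAdditive : ℕ → Set _
  IsAdditive r = ∀ x y → (x + y) ^ r ≈ x ^ r + y ^ r

  private
    module Σ = MonoidSum +-monoid

    sum-ends : ∀ {k} (t : Fin (suc (suc k)) → Carrier) → (∀ i → t (suc (inject₁ i)) ≈ 0#) →
               Σ.sum t ≈ t zero + t (fromℕ (suc k))
    sum-ends {k} t middle≈0 = +-congˡ (begin
      Σ.sum (t ∘ suc)                                ≈⟨ Σ.sum-init-last (t ∘ suc) ⟩
      Σ.sum (λ i → t (suc (inject₁ i))) + last       ≈⟨ +-congʳ (Σ.sum-cong-≋ {k} middle≈0) ⟩
      Σ.sum {k} (λ _ → 0#) + last                    ≈⟨ +-congʳ (Σ.sum-replicate-zero k) ⟩
      0# + last                                      ≈⟨ +-identityˡ last ⟩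
      last                                           ∎)
      where
      last = t (fromℕ (suc k))

  -- The inner binomial coefficients are multiples of `p`. Matching on `suc k ≡ p` makes the two
  -- ends of the sum visible.
  additive-char : IsAdditive p
  additive-char x y = additive (ℕ.suc-pred p)
    where
    additive : ∀ {k} → suc k ≡ p → (x + y) ^ p ≈ x ^ p + y ^ p
    additive {k} ≡.refl = begin
      (x + y) ^ p                                     ≈⟨ Binomial.theorem semiring x y (*-comm x y) p ⟩
      Σ.sum term                                      ≈⟨ sum-ends term middle≈0 ⟩
      term zero + term (fromℕ p)                      ≈⟨ +-cong first last ⟩
      y ^ p + x ^ p                                   ≈⟨ +-comm _ _ ⟩
      x ^ p + y ^ p                                   ∎
      where
      term : Fin (suc p) → Carrier
      term = Binomial.binomialTerm semiring x y p
      middle≈0 : ∀ i → term (suc (inject₁ i)) ≈ 0#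
      middle≈0 i = ∣⇒·≈0 (prime∣C p-prime (s≤s z≤n)
        (s≤s (≡.subst (_< k) (≡.sym (Fin.toℕ-inject₁ i)) (Fin.toℕ<n i)))) _
      first : term zero ≈ y ^ p
      first = trans (+-identityʳ _) (*-identityˡ _)
      last : term (fromℕ p) ≈ x ^ p
      last = begin
        (p C toℕ (fromℕ p)) · (x ^ toℕ (fromℕ p) * y ^ (p ℕ.∸ toℕ (fromℕ p)))
          ≡⟨ ≡.cong (λ i → (p C i) · (x ^ i * y ^ (p ℕ.∸ i))) (Fin.toℕ-fromℕ p) ⟩
        (p C p) · (x ^ p * y ^ (p ℕ.∸ p))
          ≡⟨ ≡.cong₂ (λ i j → i · (x ^ p * y ^ j)) (nCn≡1 p) (ℕ.n∸n≡0 p) ⟩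
        1 · (x ^ p * 1#)
          ≈⟨ trans (+-identityʳ _) (*-identityʳ _) ⟩
        x ^ p
          ∎

  additive-char^ : ∀ j → IsAdditive (p ℕ.^ j)
  additive-char^ zero    x y = trans (*-identityʳ _) (sym (+-cong (*-identityʳ x) (*-identityʳ y)))
  additive-char^ (suc j) x y = begin
    (x + y) ^ (p ℕ.* p ℕ.^ j)                    ≈⟨ ^-assocʳ (x + y) p (p ℕ.^ j) ⟨
    ((x + y) ^ p) ^ (p ℕ.^ j)                    ≈⟨ ^-congˡ (p ℕ.^ j) (additive-char x y) ⟩
    (x ^ p + y ^ p) ^ (p ℕ.^ j)                  ≈⟨ additive-char^ j (x ^ p) (y ^ p) ⟩
    (x ^ p) ^ (p ℕ.^ j) + (y ^ p) ^ (p ℕ.^ j)    ≈⟨ +-cong (^-assocʳ x p (p ℕ.^ j)) (^-assocʳ y p (p ℕ.^ j)) ⟩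
    x ^ (p ℕ.* p ℕ.^ j) + y ^ (p ℕ.* p ℕ.^ j)    ∎

  -- With r = p this holds for the coefficients from the prime field; with r = p^a it stands in for
  -- membership in the copy of `K` inside `L`.
  IsFixed : ℕ → Carrier → Set _
  IsFixed r x = x ^ r ≈ x

  module _ {r} .{{_ : NonZero r}} (additive : IsAdditive r) where

    fixed-0 : IsFixed r 0#
    fixed-0 = 0^ r

    fixed-+ : ∀ {x y} → IsFixed r x → IsFixed r y → IsFixed r (x + y)
    fixed-+ x-fixed y-fixed = trans (additive _ _) (+-cong x-fixed y-fixed)

    fixed-^ : ∀ {x} → IsFixed r x → ∀ i → IsFixed r (x ^ i)
    fixed-^ {x} x-fixed i = begin
      (x ^ i) ^ r      ≈⟨ ^-assocʳ x i r ⟩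
      x ^ (i ℕ.* r)    ≡⟨ ≡.cong (x ^_) (ℕ.*-comm i r) ⟩
      x ^ (r ℕ.* i)    ≈⟨ ^-assocʳ x r i ⟨
      (x ^ r) ^ i      ≈⟨ ^-congˡ i x-fixed ⟩
      x ^ i            ∎

    fixed-· : ∀ {x} → IsFixed r x → ∀ i → IsFixed r (i · x)
    fixed-· x-fixed zero    = fixed-0
    fixed-· x-fixed (suc i) = fixed-+ x-fixed (fixed-· x-fixed i)

    fixed-‿- : ∀ {x y} → IsFixed r x → IsFixed r y → IsFixed r (x - y)
    fixed-‿- {x} {y} x-fixed y-fixed = +-cancelʳ y _ _ (begin
      (x - y) ^ r + y        ≈⟨ +-congˡ y-fixed ⟨
      (x - y) ^ r + y ^ r    ≈⟨ additive (x - y) y ⟨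
      (x - y + y) ^ r        ≈⟨ ^-congˡ r x-y+y≈x ⟩
      x ^ r                  ≈⟨ x-fixed ⟩
      x                      ≈⟨ x-y+y≈x ⟨
      x - y + y              ∎)
      where
      x-y+y≈x : x - y + y ≈ x
      x-y+y≈x = trans (+-assoc x (- y) y) (trans (+-congˡ (-‿inverseˡ y)) (+-identityʳ x))

    eval-^ : ∀ {cs} → All (IsFixed r) cs → ∀ x → eval cs x ^ r ≈ eval cs (x ^ r)
    eval-^ [] x = fixed-0
    eval-^ {c ∷ cs} (c-fixed ∷ cs-fixed) x = trans (additive _ _)
      (+-cong c-fixed (trans (^-distrib-* x (eval cs x) r) (*-congˡ (eval-^ cs-fixed x))))

    -- By additivity P(x)^r = P(x^r) when the coefficients are fixed.
    conjugate-root : ∀ {cs} → All (IsFixed r) cs → ∀ {x} → eval cs x ≈ 0# → ∀ i → eval cs (x ^ (r ℕ.^ i)) ≈ 0#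
    conjugate-root {cs} cs-fixed {x} root zero    = trans (eval-cong cs (*-identityʳ x)) root
    conjugate-root {cs} cs-fixed {x} root (suc i) = begin
      eval cs (x ^ (r ℕ.* r ℕ.^ i))    ≈⟨ eval-cong cs (^-assocʳ x r (r ℕ.^ i)) ⟨
      eval cs ((x ^ r) ^ (r ℕ.^ i))    ≈⟨ conjugate-root cs-fixed root′ i ⟩
      0#                               ∎
      where
      root′ : eval cs (x ^ r) ≈ 0#
      root′ = trans (sym (eval-^ cs-fixed x)) (trans (^-congˡ r root) (0^ r))

    -- The conjugates of x are roots of any polynomial with fixed coefficients that vanishes at x.
    fixed-unique : ∀ {k x} → (∀ {i j : Fin k} → x ^ (r ℕ.^ toℕ i) ≈ x ^ (r ℕ.^ toℕ j) → i ≡ j) →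
                   ∀ {cs ds} → All (IsFixed r) cs → All (IsFixed r) ds →
                   length cs ≡ length ds → length cs ≤ k → eval cs x ≈ eval ds x → Pointwise _≈_ cs ds
    fixed-unique {k} {x} conj-inj {cs} {ds} cs-fixed ds-fixed same le eq =
      difference-zero cs ds same (roots⇒zero (zipWith _-_ cs ds) (ℕ.≤-trans (≤-length cs ds) le)
        (λ i → x ^ (r ℕ.^ toℕ i)) conj-inj
        (λ i → conjugate-root (difference-fixed cs-fixed ds-fixed)
          (trans (eval-difference cs ds same) (trans (+-congʳ eq) (-‿inverseʳ _))) (toℕ i)))
      where
      ≤-length : ∀ cs ds → length (zipWith _-_ cs ds) ≤ length cs
      ≤-length []       ds       = z≤n
      ≤-length (c ∷ cs) []       = z≤n
      ≤-length (c ∷ cs) (d ∷ ds) = s≤s (≤-length cs ds)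
      difference-fixed : ∀ {cs ds} → All (IsFixed r) cs → All (IsFixed r) ds → All (IsFixed r) (zipWith _-_ cs ds)
      difference-fixed []      _       = []
      difference-fixed (_ ∷ _) []      = []
      difference-fixed (c ∷ cs) (d ∷ ds) = fixed-‿- c d ∷ difference-fixed cs ds
      difference-zero : ∀ cs ds → length cs ≡ length ds → All (_≈ 0#) (zipWith _-_ cs ds) → Pointwise _≈_ cs ds
      difference-zero []       []       _    _          = []
      difference-zero (c ∷ cs) (d ∷ ds) same (z ∷ zs) = x-y≈0⇒x≈y z ∷ difference-zero cs ds (ℕ.suc-injective same) zs
      eval-difference : ∀ cs ds → length cs ≡ length ds → eval (zipWith _-_ cs ds) x ≈ eval cs x - eval ds x
      eval-difference []       []       _    = sym (-‿inverseʳ 0#)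
      eval-difference (c ∷ cs) (d ∷ ds) same = begin
        (c - d) + x * eval (zipWith _-_ cs ds) x    ≈⟨ +-congˡ (*-congˡ (eval-difference cs ds (ℕ.suc-injective same))) ⟩
        (c - d) + x * (P - Q)                       ≈⟨ +-congˡ (distribˡ x P (- Q)) ⟩
        (c - d) + (x * P + x * - Q)                 ≈⟨ solve 4 (λ a b c d → (a :+ b) :+ (c :+ d) := (a :+ c) :+ (b :+ d)) refl
                                                         c (- d) (x * P) (x * - Q) ⟩
        (c + x * P) + (- d + x * - Q)               ≈⟨ +-congˡ (+-congˡ (-‿distribʳ-* x Q)) ⟨
        (c + x * P) + (- d - x * Q)                 ≈⟨ +-congˡ (-‿+-comm d (x * Q)) ⟩
        (c + x * P) - (d + x * Q)                   ∎
        where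
        P = eval cs x
        Q = eval ds x

  -- Exponent lists evaluated in a field

  ev : Carrier → List ℕ → Carrier
  ev x []      = 0#
  ev x (i ∷ l) = x ^ i + ev x l

  ev-cong : ∀ {x y} → x ≈ y → ∀ l → ev x l ≈ ev y l
  ev-cong x≈y []      = refl
  ev-cong x≈y (i ∷ l) = +-cong (^-congˡ i x≈y) (ev-cong x≈y l)

  ev-++ : ∀ x l l′ → ev x (l ++ l′) ≈ ev x l + ev x l′
  ev-++ x []      l′ = sym (+-identityˡ _)
  ev-++ x (i ∷ l) l′ = trans (+-congˡ (ev-++ x l l′)) (sym (+-assoc _ _ _))

  ev-shift : ∀ x k l → ev x (map (k ℕ.+_) l) ≈ x ^ k * ev x l
  ev-shift x k []      = sym (zeroʳ _)
  ev-shift x k (i ∷ l) = trans (+-cong (^-homo-* x k i) (ev-shift x k l)) (sym (distribˡ _ _ _))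

  ev-dilate : ∀ x k l → ev x (map (k ℕ.*_) l) ≈ ev (x ^ k) l
  ev-dilate x k []      = refl
  ev-dilate x k (i ∷ l) = +-cong (sym (^-assocʳ x k i)) (ev-dilate x k l)

  ev-⊗ : ∀ x l l′ → ev x (l ⊗ l′) ≈ ev x l * ev x l′
  ev-⊗ x []      l′ = sym (zeroˡ _)
  ev-⊗ x (i ∷ l) l′ = begin
    ev x (map (i ℕ.+_) l′ ++ l ⊗ l′)          ≈⟨ ev-++ x (map (i ℕ.+_) l′) (l ⊗ l′) ⟩
    ev x (map (i ℕ.+_) l′) + ev x (l ⊗ l′)    ≈⟨ +-cong (ev-shift x i l′) (ev-⊗ x l l′) ⟩
    x ^ i * ev x l′ + ev x l * ev x l′        ≈⟨ distribʳ _ _ _ ⟨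
    (x ^ i + ev x l) * ev x l′                ∎

  ev-↑ : ∀ x l k → ev x (l ↑ k) ≈ ev x l ^ k
  ev-↑ x l zero    = +-identityʳ 1#
  ev-↑ x l (suc k) = trans (ev-⊗ x l (l ↑ k)) (*-congˡ (ev-↑ x l k))

  ev-1 : ∀ {x} → x ≈ 1# → ∀ l → ev x l ≈ length l · 1#
  ev-1 x≈1 []      = refl
  ev-1 x≈1 (i ∷ l) = +-cong (trans (^-congˡ i x≈1) (1^ i)) (ev-1 x≈1 l)

  ev-replicate : ∀ x k → ev x (replicate k 0) ≈ k · 1#
  ev-replicate x zero    = refl
  ev-replicate x (suc k) = +-congˡ (ev-replicate x k)

  ev-fixed : ∀ {r} .{{_ : NonZero r}} → IsAdditive r → ∀ {x} → IsFixed r x → ∀ l → IsFixed r (ev x l)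
  ev-fixed additive x-fixed []      = fixed-0 additive
  ev-fixed additive x-fixed (i ∷ l) = fixed-+ additive (fixed-^ additive x-fixed i) (ev-fixed additive x-fixed l)

  ev-neg : ∀ x l → ev x (neg p l) ≈ - ev x l
  ev-neg x l = begin
    ev x (replicate (p ℕ.∸ 1) 0 ⊗ l)         ≈⟨ ev-⊗ x (replicate (p ℕ.∸ 1) 0) l ⟩
    ev x (replicate (p ℕ.∸ 1) 0) * ev x l    ≈⟨ *-congʳ (ev-replicate x (p ℕ.∸ 1)) ⟩
    (p ℕ.∸ 1) · 1# * ev x l                  ≈⟨ *-congʳ [p-1]·1≈-1 ⟩
    - 1# * ev x l                            ≈⟨ -1*x≈-x (ev x l) ⟩
    - ev x l                                 ∎
    where
    [p-1]·1≈-1 : (p ℕ.∸ 1) · 1# ≈ - 1#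
    [p-1]·1≈-1 = x-y≈0⇒x≈y (begin
      (p ℕ.∸ 1) · 1# - - 1#     ≈⟨ +-congˡ (trans (-‿involutive 1#) (sym (+-identityʳ 1#))) ⟩
      (p ℕ.∸ 1) · 1# + 1 · 1#   ≈⟨ ×-homo-+ 1# (p ℕ.∸ 1) 1 ⟨
      (p ℕ.∸ 1 ℕ.+ 1) · 1#      ≡⟨ ≡.cong (_· 1#) (ℕ.m∸n+n≡m (ℕ.>-nonZero⁻¹ p)) ⟩
      p · 1#                    ≈⟨ char·1≈0 ⟩
      0#                        ∎)

  ev-∸ : ∀ x l l′ → ev x (l ++ neg p l′) ≈ ev x l - ev x l′
  ev-∸ x l l′ = trans (ev-++ x l (neg p l′)) (+-congˡ (ev-neg x l′))

  -- By Fermat, 1 − lⁿ takes the value 0 where l does not vanish and 1 where it does.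
  ev-1-^n-nonZero : ∀ {x l} → ¬ ev x l ≈ 0# → ev x (0 ∷ neg p (l ↑ n)) ≈ 0#
  ev-1-^n-nonZero {x} {l} l≉0 =
    trans (+-congˡ (trans (ev-neg x (l ↑ n)) (-‿cong (trans (ev-↑ x l n) (fermat l≉0))))) (-‿inverseʳ 1#)

  -- The exponent is arbitrary because a factor built with the number of units of one field is also
  -- evaluated in the other.
  ev-1-^-zero : ∀ {x l} k .{{_ : NonZero k}} → ev x l ≈ 0# → ev x (0 ∷ neg p (l ↑ k)) ≈ 1#
  ev-1-^-zero {x} {l} k l≈0 = begin
    1# + ev x (neg p (l ↑ k))    ≈⟨ +-congˡ (ev-neg x (l ↑ k)) ⟩
    1# - ev x (l ↑ k)            ≈⟨ +-congˡ (-‿cong (trans (ev-↑ x l k) (trans (^-congˡ k l≈0) (0^ k)))) ⟩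
    1# - 0#                      ≈⟨ +-congˡ -0#≈0# ⟩
    1# + 0#                      ≈⟨ +-identityʳ 1# ⟩
    1#                           ∎

  eval-Pointwise : ∀ {cs ds} → Pointwise _≈_ cs ds → ∀ x → eval cs x ≈ eval ds x
  eval-Pointwise []            x = refl
  eval-Pointwise (c≈d ∷ cs≈ds) x = +-cong c≈d (*-congˡ (eval-Pointwise cs≈ds x))

  eval-push : ∀ x y r q ls → r < length ls →
              eval (map (ev y) (push r q ls)) x ≈ x ^ r * y ^ q + eval (map (ev y) ls) x
  eval-push x y zero    q (l ∷ ls) _        = trans (+-congʳ (+-congʳ (sym (*-identityˡ _)))) (+-assoc _ _ _)
  eval-push x y (suc r) q (l ∷ ls) (s≤s r<) = begin
    ev y l + x * eval (map (ev y) (push r q ls)) x    ≈⟨ +-congˡ (*-congˡ (eval-push x y r q ls r<)) ⟩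
    ev y l + x * (x ^ r * y ^ q + E)                  ≈⟨ solve 5 (λ l x X Y E → l :+ x :* (X :* Y :+ E) :=
                                                                                 (x :* X) :* Y :+ (l :+ x :* E)) refl
                                                               (ev y l) x (x ^ r) (y ^ q) E ⟩
    (x * x ^ r) * y ^ q + (ev y l + x * E)            ∎
    where E = eval (map (ev y) ls) x

  eval-split : ∀ b .{{_ : NonZero b}} x l → eval (map (ev (x ^ b)) (split b l)) x ≈ ev x l
  eval-split b x []      = empty b
    where
    empty : ∀ k → eval (map (ev (x ^ b)) (replicate k [])) x ≈ 0#
    empty zero    = refl
    empty (suc k) = trans (+-identityˡ _) (trans (*-congˡ (empty k)) (zeroʳ x))
  eval-split b x (i ∷ l) = begin
    eval (map (ev (x ^ b)) (push r q (split b l))) x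
      ≈⟨ eval-push x (x ^ b) r q (split b l) (≡.subst (r <_) (≡.sym (length-split b l)) (m%n<n i b)) ⟩
    x ^ r * (x ^ b) ^ q + eval (map (ev (x ^ b)) (split b l)) x
      ≈⟨ +-cong power (eval-split b x l) ⟩
    x ^ i + ev x l
      ∎
    where
    r = i ℕ.% b
    q = i ℕ./ b
    power : x ^ r * (x ^ b) ^ q ≈ x ^ i
    power = begin
      x ^ r * (x ^ b) ^ q      ≈⟨ *-congˡ (^-assocʳ x b q) ⟩
      x ^ r * x ^ (b ℕ.* q)    ≈⟨ ^-homo-* x r (b ℕ.* q) ⟨
      x ^ (r ℕ.+ b ℕ.* q)      ≡⟨ ≡.cong (λ k → x ^ (r ℕ.+ k)) (ℕ.*-comm b q) ⟩
      x ^ (r ℕ.+ q ℕ.* b)      ≡⟨ ≡.cong (x ^_) (m≡m%n+[m/n]*n i b) ⟨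
      x ^ i                    ∎

  ev-join : ∀ b x ls → ev x (join b ls) ≈ eval (map (ev (x ^ b)) ls) x
  ev-join b x []       = refl
  ev-join b x (l ∷ ls) = begin
    ev x (map (b ℕ.*_) l ++ map suc (join b ls))          ≈⟨ ev-++ x (map (b ℕ.*_) l) _ ⟩
    ev x (map (b ℕ.*_) l) + ev x (map suc (join b ls))    ≈⟨ +-cong (ev-dilate x b l) (ev-shift x 1 (join b ls)) ⟩
    ev (x ^ b) l + x ^ 1 * ev x (join b ls)               ≈⟨ +-congˡ (*-cong (*-identityʳ x) (ev-join b x ls)) ⟩
    ev (x ^ b) l + x * eval (map (ev (x ^ b)) ls) x       ∎

  -- Reduction modulo X^c - 1: the coefficient of X^i counts the exponents congruent to i modulo
  -- `c`. It is a natural number that does not depend on the field, so vanishing modulo `p` can be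
  -- compared across fields.
  counts : (c : ℕ) → .{{NonZero c}} → List ℕ → List Carrier
  counts c l = map (λ l → length l · 1#) (split c l)

  eval-counts : ∀ c .{{_ : NonZero c}} {x} → x ^ c ≈ 1# → ∀ l → eval (counts c l) x ≈ ev x l
  eval-counts c {x} x^c≈1 l = trans (sym (eval-Pointwise (count (split c l)) x)) (eval-split c x l)
    where
    count : ∀ ls → Pointwise _≈_ (map (ev (x ^ c)) ls) (map (λ l → length l · 1#) ls)
    count []       = []
    count (l ∷ ls) = ev-1 x^c≈1 l ∷ count ls

  -- Generation by roots of unity

  conjugates-distinct : ∀ {N m x} .{{_ : NonZero m}} .{{_ : NonZero N}} → IsPrimitiveDivisor N p m → IsOrder x N →
                        ∀ {i j} → i < m → j < m → x ^ (p ℕ.^ i) ≈ x ^ (p ℕ.^ j) → i ≡ j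
  conjugates-distinct {N} {m} {x} N-primitive (x^N≈1 , N∣) {i} {j} i<m j<m eq with ℕ.≤-total i j
  ... | inj₁ i≤j = primitiveDivisor-∸ p-prime N-primitive i≤j j<m
                     (N∣ _ (^-cancel (order-nonZero x^N≈1) (ℕ.^-monoʳ-≤ p i≤j) eq))
  ... | inj₂ j≤i = ≡.sym (primitiveDivisor-∸ p-prime N-primitive j≤i i<m
                     (N∣ _ (^-cancel (order-nonZero x^N≈1) (ℕ.^-monoʳ-≤ p j≤i) (sym eq))))

  module _ {N x} .{{_ : NonZero m}} .{{_ : NonZero N}}
           (N-primitive : IsPrimitiveDivisor N p m) (x-order : IsOrder x N) where

    private
      digits : (Fin m → Fin p) → List Carrier
      digits a = tabulate (λ i → toℕ (a i) · 1#)

      digits-fixed : ∀ a → All (IsFixed p) (digits a)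
      digits-fixed a = All.tabulate⁺ (λ i → fixed-· {p} additive-char (1^ p) (toℕ (a i)))

      base-p : Fin (p ℕ.^ m) → Fin m → Fin p
      base-p = finToFun

      value : Fin (p ℕ.^ m) → Carrier
      value k = eval (digits (base-p k)) x

      value-injective : ∀ {j k} → value j ≈ value k → j ≡ k
      value-injective {j} {k} eq = finToFun-injective {m} {p} λ i → Fin.toℕ-injective
        (·1-injective (Fin.toℕ<n (base-p j i)) (Fin.toℕ<n (base-p k i)) (Pointwise.tabulate⁻ digits≈ i))
        where
        length-digits : ∀ a → length (digits a) ≡ m
        length-digits a = length-tabulate (λ i → toℕ (a i) · 1#)
        digits≈ : Pointwise _≈_ (digits (base-p j)) (digits (base-p k))
        digits≈ = fixed-unique {p} additive-char {m} {x}
          (λ eq → Fin.toℕ-injective (conjugates-distinct N-primitive x-order (Fin.toℕ<n _) (Fin.toℕ<n _) eq))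
          (digits-fixed (base-p j)) (digits-fixed (base-p k))
          (≡.trans (length-digits (base-p j)) (≡.sym (length-digits (base-p k))))
          (ℕ.≤-reflexive (length-digits (base-p j))) eq

    -- The p^m polynomials of degree below `m` with digits as coefficients take distinct values at
    -- `x`, because `x` has `m` distinct conjugates; their values therefore fill the field.
    generate : ∀ y → ∃[ l ] ev x l ≈ y
    generate y with injective⇒surjective card (index ∘ value) (value-injective ∘ index-injective) (index y)
    -- A digit d at X^i becomes d copies of the exponent i.
    ... | k , eq = join 1 (tabulate ls) , (begin
      ev x (join 1 (tabulate ls))                  ≈⟨ ev-join 1 x (tabulate ls) ⟩
      eval (map (ev (x ^ 1)) (tabulate ls)) x      ≡⟨ ≡.cong (λ cs → eval cs x) (map-tabulate ls (ev (x ^ 1))) ⟩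
      eval (tabulate (ev (x ^ 1) ∘ ls)) x          ≈⟨ eval-Pointwise (Pointwise.tabulate⁺ digit) x ⟩
      value k                                      ≈⟨ index-injective eq ⟩
      y                                            ∎)
      where
      ls : Fin m → List ℕ
      ls i = replicate (toℕ (base-p k i)) 0
      digit : ∀ i → ev (x ^ 1) (ls i) ≈ toℕ (base-p k i) · 1#
      digit i = ev-replicate (x ^ 1) (toℕ (base-p k i))

  -- Waring numbers

  IsSumOfPowers : (k s : ℕ) → Carrier → Set _
  IsSumOfPowers k s y = Σ[ x ∈ Vector Carrier s ] y ≈ Σ.sum (λ i → x i ^ k)

  -- Peeling off one summand at a time replaces a search over vectors by searches over the field.
  isSumOfPowers? : ∀ k s y → Dec (IsSumOfPowers k s y)
  isSumOfPowers? k zero    y = map′ (λ y≈0 → (λ ()) , y≈0) proj₂ (y ≟ 0#)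
  isSumOfPowers? k (suc s) y = map′ extend peel
    (any? (λ x≈x′ (z , eq) → z , trans (+-congˡ (-‿cong (^-congˡ k (sym x≈x′)))) eq)
          (λ x → isSumOfPowers? k s (y - x ^ k)))
    where
    extend : (∃[ x ] IsSumOfPowers k s (y - x ^ k)) → IsSumOfPowers k (suc s) y
    extend (x , z , eq) = (λ { zero → x ; (suc i) → z i }) , (begin
      y                          ≈⟨ +-identityˡ y ⟨
      0# + y                     ≈⟨ +-congʳ (-‿inverseʳ (x ^ k)) ⟨
      x ^ k - x ^ k + y          ≈⟨ trans (+-assoc _ _ _) (+-congˡ (+-comm _ y)) ⟩
      x ^ k + (y - x ^ k)        ≈⟨ +-congˡ eq ⟩
      x ^ k + Σ.sum (λ i → z i ^ k)  ∎)
    peel : IsSumOfPowers k (suc s) y → ∃[ x ] IsSumOfPowers k s (y - x ^ k)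
    peel (z , eq) = z zero , z ∘ suc , (begin
      y - z zero ^ k                     ≈⟨ +-congʳ (trans eq (+-comm _ _)) ⟩
      rest + z zero ^ k - z zero ^ k     ≈⟨ +-assoc _ _ _ ⟩
      rest + (z zero ^ k - z zero ^ k)   ≈⟨ +-congˡ (-‿inverseʳ _) ⟩
      rest + 0#                          ≈⟨ +-identityʳ rest ⟩
      rest                               ∎)
      where rest = Σ.sum (λ i → z (suc i) ^ k)

  everyElementIsSumOfPowers? : ∀ k s → Dec (EveryElementIsSumOfPowers F k s)
  everyElementIsSumOfPowers? k s =
    all? (λ y≈y′ (z , eq) → z , trans (sym y≈y′) eq) (isSumOfPowers? k s)

  module PowersAreRootsOfUnity {k N} .{{_ : NonZero k}} .{{_ : NonZero N}} (kN≡n : k ℕ.* N ≡ n)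
                               {x} (x-order : IsOrder x N) where

    power⇒root : ∀ y → y ^ k ≈ 0# ⊎ (∃[ j ] y ^ k ≈ x ^ j)
    power⇒root y with y ≟ 0#
    ... | yes y≈0 = inj₁ (trans (^-congˡ k y≈0) (0^ k))
    ... | no  y≉0 = inj₂ (unity⇒power x-order
      (trans (^-assocʳ y k N) (trans (reflexive (≡.cong (y ^_) kN≡n)) (fermat y≉0))))

    -- Write x^j = γ^u with γ primitive. Its `N`-th power is 1, so n = k N divides u N, and hence
    -- `k` divides u.
    root⇒power : ∀ j → ∃[ y ] y ^ k ≈ x ^ j
    root⇒power j = γ ^ v , trans (^-assocʳ γ v k) (sym (trans x^j≈γ^u (reflexive (≡.cong (γ ^_) u≡v*k))))
      where
      γ = proj₁ (exists-order n ∣-refl)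
      γ-order = proj₂ (exists-order n ∣-refl)
      [x^j]^N≈1 : (x ^ j) ^ N ≈ 1#
      [x^j]^N≈1 = trans (^-assocʳ x j N) (^-∣ (proj₁ x-order) (n∣m*n j))
      u,eq = unity⇒power γ-order (trans (reflexive (≡.cong ((x ^ j) ^_) (≡.trans (≡.sym kN≡n) (ℕ.*-comm k N))))
               (trans (sym (^-assocʳ (x ^ j) N k)) (trans (^-congˡ k [x^j]^N≈1) (1^ k))))
      u = proj₁ u,eq
      x^j≈γ^u = proj₂ u,eq
      k∣u : k ∣ u
      k∣u = *-cancelʳ-∣ N (≡.subst (_∣ u ℕ.* N) (≡.sym kN≡n)
        (proj₂ γ-order (u ℕ.* N) (trans (sym (^-assocʳ γ u N)) (trans (^-congˡ N (sym x^j≈γ^u)) [x^j]^N≈1))))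
      v = quotient k∣u
      u≡v*k = m∣n⇒n≡quotient*m k∣u

    -- Zero summands are dropped, hence `≤ s` instead of equality; `list⇒sum` pads with zeros again,
    -- whose powers vanish because `k` is nonzero.
    sum⇒list : ∀ s {y} → IsSumOfPowers k s y → ∃[ l ] length l ≤ s × ev x l ≈ y
    sum⇒list zero    (z , eq) = [] , z≤n , sym eq
    sum⇒list (suc s) (z , eq) with sum⇒list s {Σ.sum (λ i → z (suc i) ^ k)} (z ∘ suc , refl) | power⇒root (z zero)
    ... | l , le , l≈ | inj₁ ≈0 =
      l , ℕ.m≤n⇒m≤1+n le , trans l≈ (sym (trans eq (trans (+-congʳ ≈0) (+-identityˡ _))))
    ... | l , le , l≈ | inj₂ (j , ≈x^j) =
      j ∷ l , s≤s le , trans (+-cong (sym ≈x^j) l≈) (sym eq)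

    list⇒sum : ∀ s l → length l ≤ s → IsSumOfPowers k s (ev x l)
    list⇒sum zero    []      _        = (λ ()) , refl
    list⇒sum (suc s) []      _        =
      let z , eq = list⇒sum s [] z≤n in
      (λ { zero → 0# ; (suc i) → z i }) , trans (sym (+-identityˡ 0#)) (+-cong (sym (0^ k)) eq)
    list⇒sum (suc s) (j ∷ l) (s≤s le) =
      let z , eq = list⇒sum s l le ; w , w≈ = root⇒power j in
      (λ { zero → w ; (suc i) → z i }) , +-cong (sym w≈) eq

    lists⇒everyElement : ∀ {s} → (∀ y → ∃[ l ] length l ≤ s × ev x l ≈ y) → EveryElementIsSumOfPowers F k s
    lists⇒everyElement {s} lists y =
      let l , le , l≈ = lists y ; z , eq = list⇒sum s l le in z , trans (sym l≈) eq

    everyElement⇒lists : ∀ {s} → EveryElementIsSumOfPowers F k s → ∀ y → ∃[ l ] length l ≤ s × ev x l ≈ y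
    everyElement⇒lists sums y = sum⇒list _ (sums y)

    -- Each of the finitely many elements has some list by `generate`; a common bound on their
    -- lengths starts the search for the least one.
    waring-exists : .{{_ : NonZero m}} → IsPrimitiveDivisor N p m → ∃[ g ] IsWaringNumber F k g
    waring-exists N-primitive = least (everyElementIsSumOfPowers? k) {s} (lists⇒everyElement λ y →
      list (index y) , s≥ (index y) , trans (proj₂ (generate N-primitive x-order (elem (index y)))) (elem-index y))
      where
      list : Fin (suc n) → List ℕ
      list i = proj₁ (generate N-primitive x-order (elem i))
      s = proj₁ (bounded (length ∘ list))
      s≥ = proj₂ (bounded (length ∘ list))

-- Transfer of relations between roots of unity in `L` and `K`

module Comparison
  {k₁ k₂ k₃ l₁ l₂ l₃} {p : ℕ} (p-prime : Prime p)
  (K : HeytingField k₁ k₂ k₃) (nK : ℕ) (K-order : HasOrder K (suc nK)) {mK : ℕ} (K-card : suc nK ≡ p ℕ.^ mK)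
  (L : HeytingField l₁ l₂ l₃) (nL : ℕ) (L-order : HasOrder L (suc nL)) {mL : ℕ} (L-card : suc nL ≡ p ℕ.^ mL)
  where

  module K = PrimePowerField K nK K-order {m = mK} p-prime K-card
  module L = PrimePowerField L nL L-order {m = mL} p-prime L-card

  -- Since `neg` expresses differences as lists, preserving zero is enough to make `ev ζ l ↦ ev η l`
  -- a well-defined homomorphism on the ring generated by ζ.
  Specializes : L.Carrier → K.Carrier → Set _
  Specializes ζ η = ∀ l → L.ev ζ l L.≈ L.0# → K.ev η l K.≈ K.0#

  module _ {c ζ η₀} .{{_ : NonZero c}} (ζ^c≈1 : ζ L.^ c L.≈ L.1#) (η₀-order : K.IsOrder η₀ c) where

    private
      -- If no power of η₀ satisfied the relations of ζ, a product of factors 1 − lⁿ would vanish at all c-th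
      -- roots of unity in K, so its reduction modulo X^c − 1 would be divisible by p, and yet be 1 at ζ.
      Separator : ℕ → Set _
      Separator m = ∃[ l ] L.ev ζ l L.≈ L.1# × (∀ j → j < m → K.ev (η₀ K.^ j) l K.≈ K.0#)

      ¬separator : ¬ Separator c
      ¬separator (l , ζ-value , roots) = L.1≉0 (begin
        L.1#                         ≈⟨ ζ-value ⟨
        L.ev ζ l                     ≈⟨ L.eval-counts c ζ^c≈1 l ⟨
        L.eval (L.counts c l) ζ      ≈⟨ L.eval-zero (All.map⁺ counts≈0) ζ ⟩
        L.0#                         ∎)
        where
        open import Relation.Binary.Reasoning.Setoid L.setoid
        η₀^i-unity : ∀ i → (η₀ K.^ i) K.^ c K.≈ K.1#
        η₀^i-unity i = K.trans (K.^-assocʳ η₀ i c) (K.^-∣ (proj₁ η₀-order) (n∣m*n i))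
        counts≈0 : All (λ l → length l L.· L.1# L.≈ L.0#) (split c l)
        counts≈0 = All.map (λ {l} eq → L.∣⇒·1≈0 (K.·1≈0⇒∣ (length l) eq)) (All.map⁻
          (K.roots⇒zero (K.counts c l)
            (ℕ.≤-reflexive (≡.trans (length-map (λ l → length l K.· K.1#) (split c l)) (length-split c l)))
            (λ (i : Fin c) → η₀ K.^ toℕ i)
            (λ eq → Fin.toℕ-injective (K.powers-injective η₀-order (Fin.toℕ<n _) (Fin.toℕ<n _) eq))
            (λ i → K.trans (K.eval-counts c (η₀^i-unity (toℕ i)) l) (roots (toℕ i) (Fin.toℕ<n i)))))

      -- A refuted `Specializes` supplies a relation `l′` of ζ that fails at `η₀ ^ m`, but only
      -- under double negation, whence the form of the conclusion. The factor made from `l′`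
      -- vanishes at `η₀ ^ m` and keeps the value 1 at ζ.
      separators : (∀ j → ¬ Specializes ζ (η₀ K.^ j)) → ∀ m → ¬ ¬ Separator m
      separators none zero    ¬sep = ¬sep (0 ∷ [] , L.+-identityʳ L.1# , λ _ ())
      separators none (suc m) ¬sep = separators none m λ (l , ζ-value , roots) →
        none m λ l′ ζ-root → decidable-stable (K.ev (η₀ K.^ m) l′ K.≟ K.0#) λ η-nonroot →
          ¬sep (l ⊗ (0 ∷ neg p (l′ ↑ nK)) ,
            L.trans (L.ev-⊗ ζ l _) (L.trans (L.*-cong ζ-value (L.ev-1-^-zero nK ζ-root)) (L.*-identityˡ L.1#)) ,
            λ j j<1+m → K.trans (K.ev-⊗ (η₀ K.^ j) l _)
              (vanish l l′ roots η-nonroot j (ℕ.m≤n⇒m<n∨m≡n (ℕ.s≤s⁻¹ j<1+m))))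
        where
        vanish : ∀ l l′ → (∀ j → j < m → K.ev (η₀ K.^ j) l K.≈ K.0#) → ¬ K.ev (η₀ K.^ m) l′ K.≈ K.0# →
                 ∀ j → j < m ⊎ j ≡ m → K.ev (η₀ K.^ j) l K.* K.ev (η₀ K.^ j) (0 ∷ neg p (l′ ↑ nK)) K.≈ K.0#
        vanish l l′ roots nonroot j (inj₁ j<m)    = K.trans (K.*-congʳ (roots j j<m)) (K.zeroˡ _)
        vanish l l′ roots nonroot j (inj₂ ≡.refl) = K.trans (K.*-congˡ (K.ev-1-^n-nonZero {l = l′} nonroot)) (K.zeroʳ _)

    specialization-exists : ¬ (∀ j → ¬ Specializes ζ (η₀ K.^ j))
    specialization-exists none = separators none c ¬separator

  module _ {ζ η} (specializes : Specializes ζ η) where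

    -- A homomorphism out of a field is injective: if `l` vanished at η but not at ζ, then 1 - l^nL
    -- would be a relation of ζ with value 1 at η.
    specializes⁻¹ : ∀ l → K.ev η l K.≈ K.0# → L.ev ζ l L.≈ L.0#
    specializes⁻¹ l η-root = decidable-stable (L.ev ζ l L.≟ L.0#) λ ζ-nonroot →
      K.1≉0 (K.trans (K.sym (K.ev-1-^-zero nL η-root)) (specializes (0 ∷ neg p (l ↑ nL)) (L.ev-1-^n-nonZero {l = l} ζ-nonroot)))

    ev-≈⇒ : ∀ l l′ → L.ev ζ l L.≈ L.ev ζ l′ → K.ev η l K.≈ K.ev η l′
    ev-≈⇒ l l′ eq = K.x-y≈0⇒x≈y (K.trans (K.sym (K.ev-∸ η l l′)) (specializes (l ++ neg p l′)
      (L.trans (L.ev-∸ ζ l l′) (L.trans (L.+-congʳ eq) (L.-‿inverseʳ _)))))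

    ev-≈⇐ : ∀ l l′ → K.ev η l K.≈ K.ev η l′ → L.ev ζ l L.≈ L.ev ζ l′
    ev-≈⇐ l l′ eq = L.x-y≈0⇒x≈y (L.trans (L.sym (L.ev-∸ ζ l l′)) (specializes⁻¹ (l ++ neg p l′)
      (K.trans (K.ev-∸ η l l′) (K.trans (K.+-congʳ eq) (K.-‿inverseʳ _)))))

    specializes-order : ∀ {c} → L.IsOrder ζ c → K.IsOrder η c
    specializes-order {c} (ζ^c≈1 , c∣) =
      unity (ev-≈⇒ (c ∷ []) (0 ∷ []) (L.+-congʳ ζ^c≈1)) ,
      λ i η^i≈1 → c∣ i (unity′ (ev-≈⇐ (i ∷ []) (0 ∷ []) (K.+-congʳ η^i≈1)))
      where
      unity : ∀ {x} → x K.+ K.0# K.≈ K.1# K.+ K.0# → x K.≈ K.1#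
      unity eq = K.trans (K.sym (K.+-identityʳ _)) (K.trans eq (K.+-identityʳ _))
      unity′ : ∀ {x} → x L.+ L.0# L.≈ L.1# L.+ L.0# → x L.≈ L.1#
      unity′ eq = L.trans (L.sym (L.+-identityʳ _)) (L.trans eq (L.+-identityʳ _))

  -- The basis of powers of ω and the two inequalities

  module _ {b c} .{{_ : NonZero mK}} .{{_ : NonZero b}} .{{_ : NonZero c}}
           (c-primitive : IsPrimitiveDivisor c p mK) (mL≡mK*b : mL ≡ mK ℕ.* b)
           (bc-primitive : IsPrimitiveDivisor (b ℕ.* c) p mL)
           {ω} (ω-order : L.IsOrder ω (b ℕ.* c)) {η} (specializes : Specializes (ω L.^ b) η) where

    private
      ζ = ω L.^ b
      instance
        mL≢0 : NonZero mL
        mL≢0 = ≡.subst NonZero (≡.sym mL≡mK*b) (ℕ.m*n≢0 mK b)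
        bc≢0 : NonZero (b ℕ.* c)
        bc≢0 = ℕ.m*n≢0 b c
        q≢0 : NonZero (p ℕ.^ mK)
        q≢0 = ℕ.m^n≢0 p mK {{prime⇒nonZero p-prime}}

      q = p ℕ.^ mK

      ζ-order : L.IsOrder ζ c
      ζ-order = L.order-^ b c ω-order

      η-order : K.IsOrder η c
      η-order = specializes-order specializes ζ-order

      -- `c` divides q - 1, so ζ^(q-1) = 1.
      ζ-fixed : L.IsFixed q ζ
      ζ-fixed = L.trans (L.reflexive (≡.cong (ζ L.^_) (≡.sym (ℕ.m+[n∸m]≡n (ℕ.>-nonZero⁻¹ q)))))
        (L.trans (L.*-congˡ (L.^-∣ (proj₁ ζ-order) (proj₁ c-primitive))) (L.*-identityʳ ζ))

      -- q^i is p^(mK i) with mK i < mL, so these are `b` of the `mL` distinct conjugates of ω over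
      -- the prime field.
      ω-conjugates : ∀ {i j : Fin b} → ω L.^ (q ℕ.^ toℕ i) L.≈ ω L.^ (q ℕ.^ toℕ j) → i ≡ j
      ω-conjugates {i} {j} eq = Fin.toℕ-injective (ℕ.*-cancelˡ-≡ _ _ mK
        (L.conjugates-distinct bc-primitive ω-order (bound i) (bound j)
          (≡.subst₂ (λ k l → ω L.^ k L.≈ ω L.^ l) (ℕ.^-*-assoc p mK (toℕ i)) (ℕ.^-*-assoc p mK (toℕ j)) eq)))
        where
        bound : ∀ (i : Fin b) → mK ℕ.* toℕ i < mL
        bound i = ≡.subst (mK ℕ.* toℕ i <_) (≡.sym mL≡mK*b) (ℕ.*-monoʳ-< mK (Fin.toℕ<n i))

      -- 1, ω, …, ω^(b-1) are linearly independent over the subfield generated by ζ.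
      coefficients : ∀ ls f → length ls ≡ b →
                     L.eval (map (L.ev ζ) ls) ω L.≈ L.eval (map (L.ev ζ) (replicate b f)) ω →
                     All (λ l → L.ev ζ l L.≈ L.ev ζ f) ls
      coefficients ls f length≡b eq = all ls b (L.fixed-unique {q} (L.additive-char^ mK) {b} {ω} ω-conjugates
        (fixed ls) (fixed (replicate b f))
        (≡.trans (length-map (L.ev ζ) ls) (≡.trans length≡b
          (≡.sym (≡.trans (length-map (L.ev ζ) (replicate b f)) (length-replicate b)))))
        (ℕ.≤-reflexive (≡.trans (length-map (L.ev ζ) ls) length≡b)) eq)
        where
        fixed : ∀ ls → All (L.IsFixed q) (map (L.ev ζ) ls)
        fixed []       = []
        fixed (l ∷ ls) = L.ev-fixed {q} (L.additive-char^ mK) ζ-fixed l ∷ fixed ls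
        all : ∀ ls k → Pointwise L._≈_ (map (L.ev ζ) ls) (map (L.ev ζ) (replicate k f)) →
              All (λ l → L.ev ζ l L.≈ L.ev ζ f) ls
        all []       _       _        = []
        all (l ∷ ls) (suc k) (≈ ∷ ≈s) = ≈ ∷ all ls k ≈s

    module _ {kK kL} .{{_ : NonZero kK}} .{{_ : NonZero kL}}
             (kK*c≡nK : kK ℕ.* c ≡ nK) (kL*bc≡nL : kL ℕ.* (b ℕ.* c) ≡ nL) where

      private
        module KPowers = K.PowersAreRootsOfUnity kK*c≡nK η-order
        module LPowers = L.PowersAreRootsOfUnity kL*bc≡nL ω-order

      -- Each of the `b` coefficients of y is shortened in `K` and brought back to `L` by
      -- injectivity of the specialization.
      upper : ∀ {g} → EveryElementIsSumOfPowers K kK g → EveryElementIsSumOfPowers L kL (b ℕ.* g)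
      upper {g} K-sums = LPowers.lists⇒everyElement λ y →
        let l , l≈y = L.generate bc-primitive ω-order y
            ls = split b l
        in join b (map short ls) ,
           ℕ.≤-trans (ℕ.≤-reflexive (length-join b (map short ls)))
             (≡.subst (λ i → sum (map length (map short ls)) ≤ i ℕ.* g) (≡.trans (length-map short ls) (length-split b l))
               (sum-map≤ (map short ls) (shorts ls))) ,
           L.trans (L.ev-join b ω (map short ls)) (L.trans (L.eval-Pointwise (short≈ ls) ω) (L.trans (L.eval-split b ω l) l≈y))
        where
        representation : ∀ l → ∃[ l′ ] length l′ ≤ g × K.ev η l′ K.≈ K.ev η l
        representation l = KPowers.everyElement⇒lists K-sums (K.ev η l)
        short : List ℕ → List ℕ
        short l = proj₁ (representation l)
        shorts : ∀ ls → All (λ l → length l ≤ g) (map short ls)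
        shorts []       = []
        shorts (l ∷ ls) = proj₁ (proj₂ (representation l)) ∷ shorts ls
        short≈ : ∀ ls → Pointwise L._≈_ (map (L.ev ζ) (map short ls)) (map (L.ev ζ) ls)
        short≈ []       = []
        short≈ (l ∷ ls) = ev-≈⇐ specializes (short l) l (proj₂ (proj₂ (representation l))) ∷ short≈ ls

      private
        -- By independence every list in `split b l` represents the same element as `f`, while their
        -- lengths add up to less than b g.
        short-class : ∀ {g} f l → length l < b ℕ.* g → L.ev ω l L.≈ L.eval (map (L.ev ζ) (replicate b f)) ω →
                      ∃[ l′ ] length l′ < g × L.ev ζ l′ L.≈ L.ev ζ f
        short-class {g} f l l<b*g l≈ = below-average {P = λ l′ → L.ev ζ l′ L.≈ L.ev ζ f} {g} {split b l}
          (coefficients (split b l) f (length-split b l) (L.trans (L.eval-split b ω l) l≈))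
          (≡.subst (λ i → sum (map length (split b l)) < i ℕ.* g) (≡.sym (length-split b l))
            (ℕ.≤-<-trans (sum-split b l) l<b*g))

      -- The test element has the same coefficient y, represented by `f`, at each of 1, ω, ...,
      -- ω^(b-1). With fewer than b (g + 1) terms, some coefficient uses at most g of them, and that
      -- list already represents y in `K`. Every y is treated alike, so no hardest one has to be
      -- chosen.
      lower : ∀ {g h} → EveryElementIsSumOfPowers L kL h → h < b ℕ.* suc g → EveryElementIsSumOfPowers K kK g
      lower {g} {h} L-sums h<b[1+g] = KPowers.lists⇒everyElement short
        where
        class : ∀ f → (∃[ l ] length l ≤ h × L.ev ω l L.≈ L.eval (map (L.ev ζ) (replicate b f)) ω) →
                ∃[ l ] length l < suc g × L.ev ζ l L.≈ L.ev ζ f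
        class f (l , l≤h , l≈) = short-class f l (ℕ.≤-<-trans l≤h h<b[1+g]) l≈
        transfer : ∀ {y} f → K.ev η f K.≈ y → (∃[ l ] length l < suc g × L.ev ζ l L.≈ L.ev ζ f) →
                   ∃[ l ] length l ≤ g × K.ev η l K.≈ y
        transfer f f≈y (l , l<1+g , l≈f) = l , ℕ.s≤s⁻¹ l<1+g , K.trans (ev-≈⇒ specializes l f l≈f) f≈y
        short : ∀ y → ∃[ l ] length l ≤ g × K.ev η l K.≈ y
        short y = uncurry (λ f f≈y → transfer f f≈y (class f (LPowers.everyElement⇒lists L-sums _)))
                          (K.generate c-primitive η-order y)

      waring-* : ∀ {g h} → IsWaringNumber K kK g → IsWaringNumber L kL h → h ≡ b ℕ.* g
      waring-* {g} {h} (K-sums , g≤) (L-sums , h≤) =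
        ℕ.≤-antisym (h≤ (b ℕ.* g) (upper K-sums)) (ℕ.≮⇒≥ (not-below g g≤))
        where
        not-below : ∀ g → (∀ t → EveryElementIsSumOfPowers K kK t → g ≤ t) → ¬ h < b ℕ.* g
        not-below zero    _  h<b0     = contradiction (≡.subst (h <_) (ℕ.*-zeroʳ b) h<b0) ℕ.n≮0
        not-below (suc g) g≤ h<b[1+g] = contradiction (g≤ g (lower L-sums h<b[1+g])) (ℕ.<⇒≱ (ℕ.n<1+n g))

open import Algebra.Apartness.Bundles using (HeytingField)
open import Data.Nat.Base using (ℕ; _*_; _∸_; _^_; _/_; NonZero)
open import Data.Nat.Primality using (Prime)
open import Data.Nat.Properties using (m*n≢0)
open import Data.Product.Base using (_×_; ∃-syntax)
open import Relation.Binary.PropositionalEquality using (_≡_)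

mainTheorem3 : ∀ {k₁ k₂ k₃ l₁ l₂ l₃} (p a b c : ℕ) .{{_ : NonZero a}} .{{_ : NonZero b}} .{{_ : NonZero c}} →
    Prime p →
    IsPrimitiveDivisor c p a →
    IsPrimitiveDivisor (b * c) p (a * b) →
    (K : HeytingField k₁ k₂ k₃) → HasOrder K (p ^ a) →
    (L : HeytingField l₁ l₂ l₃) → HasOrder L (p ^ (a * b)) →
    ∃[ g ] ∃[ h ]
    IsWaringNumber K ((p ^ a ∸ 1) / c) g ×
    IsWaringNumber L (_/_ (p ^ (a * b) ∸ 1) (b * c) {{m*n≢0 b c}}) h ×
    h ≡ b * g
mainTheorem3 p a b c p-prime c-primitive bc-primitive K K-order L L-order =
  proj₁ g , proj₁ h , proj₂ g , proj₂ h ,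
  -- Both Waring numbers are fixed before any specialization is chosen, so decidability of the
  -- equation removes the double negation on its existence.
  decidable-stable (proj₁ h ℕ.≟ b * proj₁ g) λ h≢bg →
    specialization-exists {c} (proj₁ ζ-order) (proj₂ η₀) λ j specializes →
      h≢bg (waring-* c-primitive ≡.refl bc-primitive (proj₂ ω) specializes {kK} {kL} kK*c≡ kL*bc≡ (proj₂ g) (proj₂ h))
  where
  instance
    p≢0 = prime⇒nonZero p-prime
    ab≢0 = m*n≢0 a b
    bc≢0 = m*n≢0 b c
  card : ∀ m → suc (p ^ m ∸ 1) ≡ p ^ m
  card m = ℕ.m+[n∸m]≡n (ℕ.m^n>0 p m)
  open Comparison p-prime K (p ^ a ∸ 1) (≡.subst (HasOrder K) (≡.sym (card a)) K-order) {a} (card a)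
                          L (p ^ (a * b) ∸ 1) (≡.subst (HasOrder L) (≡.sym (card (a * b))) L-order) {a * b} (card (a * b))
  kK = (p ^ a ∸ 1) / c
  kL = (p ^ (a * b) ∸ 1) / (b * c)
  kK*c≡ : kK * c ≡ p ^ a ∸ 1
  kK*c≡ = m/n*n≡m (proj₁ c-primitive)
  kL*bc≡ : kL * (b * c) ≡ p ^ (a * b) ∸ 1
  kL*bc≡ = m/n*n≡m (proj₁ bc-primitive)
  instance
    kK≢0 = ℕ.m*n≢0⇒m≢0 kK {{≡.subst NonZero (≡.sym kK*c≡) K.n≢0}}
    kL≢0 = ℕ.m*n≢0⇒m≢0 kL {{≡.subst NonZero (≡.sym kL*bc≡) L.n≢0}}
  η₀ = K.exists-order c (proj₁ c-primitive)
  ω = L.exists-order (b * c) (proj₁ bc-primitive)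
  ζ-order = L.order-^ b c (proj₂ ω)
  g = K.PowersAreRootsOfUnity.waring-exists {kK} kK*c≡ (proj₂ η₀) c-primitive
  h = L.PowersAreRootsOfUnity.waring-exists {kL} kL*bc≡ (proj₂ ω) bc-primitive
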